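{- Let $k,n,m\ge1$ be integers. For $\alpha=(\alpha_1,\ldots,\alpha_m)\in\mathbb{N}^m$ let $D_\alpha(k,n,m)$ be the number of plane partitions $\pi\in\mathrm{PP}(k,n,m)$ with exactly $\alpha_i$ descents of entry $i$ for each $i\in\{1,\ldots,m\}$; equivalently, such that for each $i\in\{1,\ldots,m\}$ the entry $i$ appears in exactly $\alpha_i$ columns of $\pi$. Then: (i) (symmetry) $D_\alpha(k,n,m)$ does not change under permutations of $(\alpha_1,\ldots,\alpha_m)$. (ii) (monotonicity) For $\alpha,\beta\in\mathbb{N}^m$ with $\beta\succeq\alpha$ and $|\alpha|=|\beta|$, one has $D_\alpha(k,n,m)\ge D_\beta(k,n,m)$.
   Context: $\mathbb{N}=\{0,1,2,\ldots\}$ and $|\alpha|=\alpha_1+\cdots+\alpha_m$. A plane partition $\pi=(\pi_{ij})_{i,j\ge1}$ is a two-dimensional array of nonnegative integers with finitely many nonzero entries such that $\pi_{ij}\ge\pi_{i+1\,j}$ and $\pi_{ij}\ge\pi_{i\,j+1}$ for all $i,j\ge1$ ($i$ is the row index, $j$ the column index). $\mathrm{PP}(k,n,m)$ is the set of plane partitions whose first row has at most $k$ nonzero entries, whose first column has at most $n$ nonzero entries, and whose first entry $\pi_{11}$ is at most $m$. A descent of entry $i$ in $\pi$ is a cell $(r,j)$ with $\pi_{rj}=i>\pi_{r+1\,j}$. For $\alpha,\beta\in\mathbb{N}^m$ we write $\beta\succeq\alpha$ ($\beta$ dominates $\alpha$) if $\sum_{i=1}^{\ell}\beta_i\ge\sum_{i=1}^{\ell}\alpha_i$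 for all $\ell\in\{1,\ldots,m\}$.
   Formalization: In (ii), α is assumed weakly decreasing (β arbitrary); without this (ii) fails, e.g. k=1, n=m=2, α=(0,2), β=(1,1), where D_α=0 < D_β=1. The equivalent description by the number of columns containing i is not stated. -}

module Defs where

open import Data.Empty using (⊥-elim)
open import Data.Fin using (Fin; zero; suc; toℕ; fromℕ<; finToFun; funToFin; combine; remQuot)
import Data.Fin as Fin
import Data.Fin.Properties as Finₚ
open import Data.Fin.Permutation using (↔⇒≡)
open import Data.List using (take; tabulate)
open import Data.Nat using (ℕ; zero; suc; _*_; _^_; _≤_; _<_; _≥_; _>_; z≤n; s≤s; _<?_; _≤?_; _≟_)
open import Data.Nat.ListAction using (sum)
open import Data.Nat.Properties
  using (≤-trans; ≤-reflexive; ≮⇒≥; <⇒≱; ≤∧≢⇒<; ≤-pred; n≤0⇒n≡0; m≤n⇒m≤1+n; allUpTo?)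
open import Data.Product using (Σ; ∃; _×_; _,_; proj₁; proj₂)
open import Data.Product.Properties using (,-injective)
open import Data.Vec.Functional using (Vector)
open import Function using (_∘_; Inverse)
import Function.Construct.Composition as Comp
import Function.Construct.Symmetry as Symm
open import Level using (0ℓ)
open import Relation.Binary using (Setoid; _Respects_)
import Relation.Binary.Construct.On as On
open import Relation.Binary.PropositionalEquality
  using (_≡_; _≢_; _≗_; _→-setoid_; refl; sym; trans; cong; cong₂; subst; subst₂)
import Relation.Binary.PropositionalEquality as ≡
open import Relation.Nullary using (Dec; yes; no)
open import Relation.Nullary.Decidable using (map′; _×-dec_; ¬?)

open Setoid using (Carrier)

-- The subset of S cut out by P: two elements are identified as soon as the
-- underlying elements of S are, whatever the proofs of P.
subset : (S : Setoid 0ℓ 0ℓ) → (Carrier S → Set) → Setoid 0ℓ 0ℓ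
subset S P = On.setoid S (proj₁ {B = P})

HasSize : (S : Setoid 0ℓ 0ℓ) → (Carrier S → Set) → ℕ → Set
HasSize S P c = Inverse (≡.setoid (Fin c)) (subset S P)

Exactly : {A : Set} → ℕ → (A → Set) → Set
Exactly {A} c P = HasSize (≡.setoid A) P c

AtMost : {A : Set} → ℕ → (A → Set) → Set
AtMost k P = ∃ λ c → c ≤ k × Exactly c P

FinitelyMany : {A : Set} → (A → Set) → Set
FinitelyMany P = ∃ λ c → Exactly c P

-- Rows and columns are numbered from 0: π (i , j) is the entry usually
-- written π_{i+1,j+1}, with i the row index.
Array : Set
Array = ℕ × ℕ → ℕ

arrays : Setoid 0ℓ 0ℓ
arrays = (ℕ × ℕ) →-setoid ℕ

record IsPlanePartition (π : Array) : Set where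
  field
    finiteSupport : FinitelyMany λ c → π c ≢ 0
    columns       : ∀ i j → π (i , j) ≥ π (suc i , j)
    rows          : ∀ i j → π (i , j) ≥ π (i , suc j)

record PP (k n m : ℕ) (π : Array) : Set where
  field
    isPlanePartition : IsPlanePartition π
    firstRow         : AtMost k λ j → π (0 , j) ≢ 0
    firstColumn      : AtMost n λ i → π (i , 0) ≢ 0
    firstEntry       : π (0 , 0) ≤ m

IsDescent : Array → ℕ → ℕ × ℕ → Set
IsDescent π i (r , j) = π (r , j) ≡ i × i > π (suc r , j)

-- An index i : Fin m stands for the entry suc (toℕ i) ∈ {1 , … , m}.
PPWithDescents : (k n m : ℕ) → Vector ℕ m → Array → Set
PPWithDescents k n m α π =
  PP k n m π × (∀ i → Exactly (α i) (IsDescent π (suc (toℕ i))))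

partialSum : ∀ {m} → ℕ → Vector ℕ m → ℕ
partialSum ℓ α = sum (take ℓ (tabulate α))

∣_∣ : ∀ {m} → Vector ℕ m → ℕ
∣ α ∣ = sum (tabulate α)

_⪰_ : ∀ {m} → Vector ℕ m → Vector ℕ m → Set
_⪰_ {m} β α = ∀ ℓ → 1 ≤ ℓ → ℓ ≤ m → partialSum ℓ β ≥ partialSum ℓ α

-- _⪰_ does not sort its arguments, so monotonicity of D under it needs the
-- dominated vector to be weakly decreasing: (1 , 1) ⪰ (0 , 2), but
-- D 1 2 2 (0 , 2) = 0 and D 1 2 2 (1 , 1) = 1.
WeaklyDecreasing : ∀ {m} → Vector ℕ m → Set
WeaklyDecreasing α = ∀ i j → i Fin.≤ j → α i ≥ α j

-- The rest shows that PPWithDescents k n m α is finite, so that its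
-- number of elements is defined.

HasSize-unique : ∀ {S P c d} → HasSize S P c → HasSize S P d → c ≡ d
HasSize-unique p q = ↔⇒≡ (Comp.inverse p (Symm.inverse q))

HasSize-resp : ∀ {S P Q c} → (∀ {x} → P x → Q x) → (∀ {x} → Q x → P x) →
               HasSize S P c → HasSize S Q c
HasSize-resp {S} P⇒Q Q⇒P p = record
  { to        = λ x → proj₁ (to x) , P⇒Q (proj₂ (to x))
  ; from      = λ (x , q) → from (x , Q⇒P q)
  ; to-cong   = to-cong
  ; from-cong = from-cong
  ; inverse   = (λ eq → inverseˡ eq) , (λ eq → inverseʳ eq)
  }
  where open Inverse p

sizeFin : ∀ {N} (P : Fin N → Set) → (∀ x → Dec (P x)) → FinitelyMany P
sizeFin {zero} P P? = 0 , record
  { to = λ () ; from = λ () ; to-cong = λ { {()} } ; from-cong = λ { {()} }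
  ; inverse = (λ { {()} }) , (λ { {()} }) }
sizeFin {suc N} P P? with P? zero | sizeFin (P ∘ suc) (P? ∘ suc)
... | yes p | c , I = suc c , record
  { to = t ; from = f ; to-cong = λ { refl → refl } ; from-cong = fc
  ; inverse = (λ { refl → tf _ }) , (λ {x} eq → trans (fc eq) (ft x)) }
  where
  open Inverse I
  t : Fin (suc c) → Σ (Fin (suc N)) P
  t zero    = zero , p
  t (suc x) = suc (proj₁ (to x)) , proj₂ (to x)
  f : Σ (Fin (suc N)) P → Fin (suc c)
  f (zero  , _) = zero
  f (suc x , q) = suc (from (x , q))
  fc : ∀ {x y} → proj₁ x ≡ proj₁ y → f x ≡ f y
  fc {zero  , _} {zero  , _} _  = refl
  fc {suc x , _} {suc y , _} eq = cong suc (from-cong (Finₚ.suc-injective eq))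
  tf : ∀ y → proj₁ (t (f y)) ≡ proj₁ y
  tf (zero  , _) = refl
  tf (suc x , q) = cong suc (inverseˡ {y = from (x , q)} refl)
  ft : ∀ x → f (t x) ≡ x
  ft zero    = refl
  ft (suc x) = cong suc (inverseʳ refl)
... | no ¬p | c , I = c , record
  { to = t ; from = f ; to-cong = λ { refl → refl } ; from-cong = fc
  ; inverse = (λ { refl → tf _ }) , (λ {x} eq → trans (fc eq) (ft x)) }
  where
  open Inverse I
  t : Fin c → Σ (Fin (suc N)) P
  t x = suc (proj₁ (to x)) , proj₂ (to x)
  f : Σ (Fin (suc N)) P → Fin c
  f (zero  , q) = ⊥-elim (¬p q)
  f (suc x , q) = from (x , q)
  fc : ∀ {x y} → proj₁ x ≡ proj₁ y → f x ≡ f y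
  fc {zero  , q} {_}         _  = ⊥-elim (¬p q)
  fc {suc x , _} {zero  , q} _  = ⊥-elim (¬p q)
  fc {suc x , _} {suc y , _} eq = from-cong (Finₚ.suc-injective eq)
  tf : ∀ y → proj₁ (t (f y)) ≡ proj₁ y
  tf (zero  , q) = ⊥-elim (¬p q)
  tf (suc x , q) = cong suc (inverseˡ {y = from (x , q)} refl)
  ft : ∀ x → f (t x) ≡ x
  ft x = inverseʳ refl

module _ (S : Setoid 0ℓ 0ℓ) (P : Carrier S → Set) where
  open Setoid S using (_≈_)
    renaming (trans to ≈-trans; sym to ≈-sym; reflexive to ≈-reflexive)

  sizeCovered : (P Respects _≈_) → ∀ {N} (e : Fin N → Carrier S) →
                (∀ {x y} → e x ≈ e y → x ≡ y) → (∀ x → Dec (P (e x))) →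
                (∀ a → P a → ∃ λ x → e x ≈ a) → ∃ (HasSize S P)
  sizeCovered resp {N} e inj P? cover = proj₁ I , Comp.inverse (proj₂ I) record
    { to        = λ (x , p) → e x , p
    ; from      = λ (a , p) → proj₁ (cover a p) , resp (≈-sym (proj₂ (cover a p))) p
    ; to-cong   = λ eq → ≈-reflexive (cong e eq)
    ; from-cong = λ { {a , p} {b , q} eq →
        inj (≈-trans (proj₂ (cover a p)) (≈-trans eq (≈-sym (proj₂ (cover b q))))) }
    ; inverse   = (λ { {a , p} eq → ≈-trans (≈-reflexive (cong e eq)) (proj₂ (cover a p)) })
                , (λ { {x , p} {b , q} eq → inj (≈-trans (proj₂ (cover b q)) eq) })
    }
    where I = sizeFin (P ∘ e) P?

sizeℕ : (P : ℕ → Set) → (∀ x → Dec (P x)) → ∀ N → (∀ x → P x → x < N) →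
        AtMost N P
sizeℕ P P? N bound = proj₁ s , c≤N , proj₂ s
  where
  s : FinitelyMany P
  s = sizeCovered (≡.setoid ℕ) P (subst P) (toℕ {N}) Finₚ.toℕ-injective (P? ∘ toℕ)
        λ a p → fromℕ< (bound a p) , Finₚ.toℕ-fromℕ< (bound a p)
  open Inverse (proj₂ s)
  c≤N : proj₁ s ≤ N
  c≤N = Finₚ.injective⇒≤ {f = λ x → fromℕ< (bound _ (proj₂ (to x)))} λ {x} {y} eq →
    trans (sym (inverseʳ {x} {to x} refl)) (inverseʳ
      (trans (sym (Finₚ.toℕ-fromℕ< (bound _ (proj₂ (to x)))))
        (trans (cong toℕ eq) (Finₚ.toℕ-fromℕ< (bound _ (proj₂ (to y)))))))

sizeℕ² : (P : ℕ × ℕ → Set) → (∀ x → Dec (P x)) → ∀ n k →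
         (∀ i j → P (i , j) → i < n × j < k) → FinitelyMany P
sizeℕ² P P? n k bound =
  sizeCovered (≡.setoid (ℕ × ℕ)) P (subst P) e
    (λ {x} {y} eq → trans (sym (Finₚ.combine-remQuot {n} k x)) (trans
      (cong₂ combine (Finₚ.toℕ-injective (proj₁ (,-injective eq)))
                     (Finₚ.toℕ-injective (proj₂ (,-injective eq))))
      (Finₚ.combine-remQuot {n} k y)))
    (P? ∘ e) cover
  where
  e : Fin (n * k) → ℕ × ℕ
  e x = toℕ (proj₁ (remQuot {n} k x)) , toℕ (proj₂ (remQuot {n} k x))
  cover : ∀ a → P a → ∃ λ x → e x ≡ a
  cover (i , j) p with bound i j p
  ... | i<n , j<k = combine (fromℕ< i<n) (fromℕ< j<k) , trans
    (cong (λ (u , v) → toℕ u , toℕ v) (Finₚ.remQuot-combine (fromℕ< i<n) (fromℕ< j<k)))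
    (cong₂ _,_ (Finₚ.toℕ-fromℕ< i<n) (Finₚ.toℕ-fromℕ< j<k))

prefix≤size : (f : ℕ → ℕ) → (∀ j → f j ≥ f (suc j)) →
              ∀ {k} → AtMost k (λ j → f j ≢ 0) → ∀ j → k ≤ j → f j ≡ 0
prefix≤size f dec {k} (c , c≤k , I) j k≤j with f j ≟ 0
... | yes eq = eq
... | no ne  = ⊥-elim (<⇒≱ (≤-trans (s≤s c≤k) (s≤s k≤j))
                 (Finₚ.injective⇒≤ {f = g} g-inj))
  where
  open Inverse I
  below : ∀ a b → a ≤ b → f b ≢ 0 → f a ≢ 0
  below a zero    z≤n fb fa = fb fa
  below a (suc b) a≤  fb with a ≟ suc b
  ... | yes refl = fb
  ... | no a≢    = below a b (≤-pred (≤∧≢⇒< a≤ a≢)) λ fb≡0 →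
                     fb (n≤0⇒n≡0 (≤-trans (dec b) (≤-reflexive fb≡0)))
  pt : Fin (suc j) → Σ ℕ (λ j → f j ≢ 0)
  pt x = toℕ x , below (toℕ x) j (≤-pred (Finₚ.toℕ<n x)) ne
  g : Fin (suc j) → Fin c
  g x = from (pt x)
  g-inj : ∀ {x y} → g x ≡ g y → x ≡ y
  g-inj {x} {y} eq = Finₚ.toℕ-injective
    (trans (sym (inverseˡ {pt x} {g x} refl)) (inverseˡ {pt y} {g x} eq))

-- The elements of PP k n m are the n × k arrays with weakly decreasing rows
-- and columns and entries in {0 , … , m}, extended by zeros.
record BoxedPP (k n m : ℕ) (π : Array) : Set where
  field
    columns : ∀ i j → π (i , j) ≥ π (suc i , j)
    rows    : ∀ i j → π (i , j) ≥ π (i , suc j)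
    below   : ∀ i j → n ≤ i → π (i , j) ≡ 0
    right   : ∀ i j → k ≤ j → π (i , j) ≡ 0
    corner  : π (0 , 0) ≤ m

  inRow : ∀ i j → π (i , j) ≢ 0 → i < n
  inRow i j ne with i <? n
  ... | yes lt = lt
  ... | no ≮   = ⊥-elim (ne (below i j (≮⇒≥ ≮)))

  inColumn : ∀ i j → π (i , j) ≢ 0 → j < k
  inColumn i j ne with j <? k
  ... | yes lt = lt
  ... | no ≮   = ⊥-elim (ne (right i j (≮⇒≥ ≮)))

  entry≤m : ∀ i j → π (i , j) ≤ m
  entry≤m zero    zero    = corner
  entry≤m zero    (suc j) = ≤-trans (rows zero j) (entry≤m zero j)
  entry≤m (suc i) j       = ≤-trans (columns i j) (entry≤m i j)

  finitelyManyDescents : ∀ e → FinitelyMany (IsDescent π (suc e))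
  finitelyManyDescents e = sizeℕ² _
    (λ (r , j) → (π (r , j) ≟ suc e) ×-dec (π (suc r , j) <? suc e)) n k
    λ i j (eq , _) → let ne = λ z → 1+≢0 (trans (sym eq) z) in inRow i j ne , inColumn i j ne
    where
    1+≢0 : ∀ {x} → suc x ≢ 0
    1+≢0 ()

Boxed⇒PP : ∀ {k n m π} → BoxedPP k n m π → PP k n m π
Boxed⇒PP {k} {n} {m} {π} b = record
  { isPlanePartition = record
      { finiteSupport = sizeℕ² _ (λ c → ¬? (π c ≟ 0)) n k
                          λ i j ne → inRow i j ne , inColumn i j ne
      ; columns = columns
      ; rows    = rows
      }
  ; firstRow    = sizeℕ _ (λ j → ¬? (π (0 , j) ≟ 0)) k (inColumn 0)
  ; firstColumn = sizeℕ _ (λ i → ¬? (π (i , 0) ≟ 0)) n (λ i → inRow i 0)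
  ; firstEntry  = corner
  }
  where open BoxedPP b

PP⇒Boxed : ∀ {k n m π} → PP k n m π → BoxedPP k n m π
PP⇒Boxed {k} {n} {m} {π} p = record
  { columns = columns
  ; rows    = rows
  ; below   = below
  ; right   = right
  ; corner  = firstEntry
  }
  where
  open PP p
  open IsPlanePartition isPlanePartition
  below : ∀ i j → n ≤ i → π (i , j) ≡ 0
  below i zero    n≤i = prefix≤size (λ i → π (i , 0)) (λ i → columns i 0) firstColumn i n≤i
  below i (suc j) n≤i = n≤0⇒n≡0 (≤-trans (rows i j) (≤-reflexive (below i j n≤i)))
  right : ∀ i j → k ≤ j → π (i , j) ≡ 0
  right zero    j k≤j = prefix≤size (λ j → π (0 , j)) (rows 0) firstRow j k≤j
  right (suc i) j k≤j = n≤0⇒n≡0 (≤-trans (columns i j) (≤-reflexive (right i j k≤j)))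

BoxedPP-resp : ∀ {k n m π ρ} → π ≗ ρ → BoxedPP k n m π → BoxedPP k n m ρ
BoxedPP-resp eq b = record
  { columns = λ i j → subst₂ _≤_ (eq _) (eq _) (columns i j)
  ; rows    = λ i j → subst₂ _≤_ (eq _) (eq _) (rows i j)
  ; below   = λ i j p → trans (sym (eq _)) (below i j p)
  ; right   = λ i j p → trans (sym (eq _)) (right i j p)
  ; corner  = ≤-trans (≤-reflexive (sym (eq _))) corner
  }
  where open BoxedPP b

resp : ∀ {k n m} (α : Vector ℕ m) → PPWithDescents k n m α Respects _≗_
resp α eq (p , d) = Boxed⇒PP (BoxedPP-resp eq (PP⇒Boxed p)) , λ i →
  HasSize-resp (move eq) (move (sym ∘ eq)) (d i)
  where
  move : ∀ {π ρ e c} → π ≗ ρ → IsDescent π e c → IsDescent ρ e c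
  move eq (p , q) = trans (sym (eq _)) p , subst (_< _) (eq _) q

module Enumeration (k n m : ℕ) where

  Code : Set
  Code = Fin ((suc m ^ k) ^ n)

  matrix : Code → Fin n → Fin k → Fin (suc m)
  matrix x i j = finToFun (finToFun x i) j

  array : Code → Array
  array x (i , j) with i <? n | j <? k
  ... | yes i<n | yes j<k = toℕ (matrix x (fromℕ< i<n) (fromℕ< j<k))
  ... | _       | _       = 0

  array-in : ∀ x i j → array x (toℕ i , toℕ j) ≡ toℕ (matrix x i j)
  array-in x i j with toℕ i <? n | toℕ j <? k
  ... | yes p | yes q = cong₂ (λ i j → toℕ (matrix x i j)) (Finₚ.fromℕ<-toℕ i p) (Finₚ.fromℕ<-toℕ j q)
  ... | yes p | no ¬q = ⊥-elim (¬q (Finₚ.toℕ<n j))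
  ... | no ¬p | _     = ⊥-elim (¬p (Finₚ.toℕ<n i))

  array-below : ∀ x i j → n ≤ i → array x (i , j) ≡ 0
  array-below x i j n≤i with i <? n | j <? k
  ... | yes p | _     = ⊥-elim (<⇒≱ p n≤i)
  ... | no _  | yes _ = refl
  ... | no _  | no _  = refl

  array-right : ∀ x i j → k ≤ j → array x (i , j) ≡ 0
  array-right x i j k≤j with i <? n | j <? k
  ... | _     | yes q = ⊥-elim (<⇒≱ q k≤j)
  ... | yes _ | no _  = refl
  ... | no _  | no _  = refl

  funToFin-cong : ∀ {a b} {f g : Fin a → Fin b} → f ≗ g → funToFin f ≡ funToFin g
  funToFin-cong {zero}  eq = refl
  funToFin-cong {suc a} eq = cong₂ combine (eq zero) (funToFin-cong (eq ∘ suc))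

  finToFun-inj : ∀ a b {x y : Fin (b ^ a)} → finToFun {b} {a} x ≗ finToFun {b} {a} y → x ≡ y
  finToFun-inj a b {x} {y} eq = trans (sym (Finₚ.funToFin-finToFin {a} {b} x))
    (trans (funToFin-cong eq) (Finₚ.funToFin-finToFin {a} {b} y))

  array-inj : ∀ {x y} → array x ≗ array y → x ≡ y
  array-inj {x} {y} eq = finToFun-inj n (suc m ^ k) λ i → finToFun-inj k (suc m) λ j →
    Finₚ.toℕ-injective (trans (sym (array-in x i j)) (trans (eq _) (array-in y i j)))

  cover : ∀ π → BoxedPP k n m π → ∃ λ x → array x ≗ π
  cover π b = code , λ (i , j) → agree i j
    where
    open BoxedPP b
    M : Fin n → Fin k → Fin (suc m)
    M i j = fromℕ< (s≤s (entry≤m (toℕ i) (toℕ j)))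
    code : Code
    code = funToFin (funToFin ∘ M)
    matrix-code : ∀ i j → matrix code i j ≡ M i j
    matrix-code i j = trans
      (cong (λ z → finToFun z j) (Finₚ.finToFun-funToFin {n} (funToFin ∘ M) i))
      (Finₚ.finToFun-funToFin (M i) j)
    agree : ∀ i j → array code (i , j) ≡ π (i , j)
    agree i j with i <? n | j <? k
    ... | yes p | yes q = trans (cong toℕ (matrix-code (fromℕ< p) (fromℕ< q))) (trans
      (Finₚ.toℕ-fromℕ< _)
      (cong₂ (λ i j → π (i , j)) (Finₚ.toℕ-fromℕ< p) (Finₚ.toℕ-fromℕ< q)))
    ... | yes p | no ¬q = sym (right i j (≮⇒≥ ¬q))
    ... | no ¬p | yes _ = sym (below i j (≮⇒≥ ¬p))
    ... | no ¬p | no _  = sym (below i j (≮⇒≥ ¬p))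

  box? : {P : ℕ → ℕ → Set} → (∀ i j → Dec (P i j)) →
         (∀ i j → n ≤ i → P i j) → (∀ i j → k ≤ j → P i j) → Dec (∀ i j → P i j)
  box? {P} P? lo hi = map′ widen (λ f _ _ → f _ _)
    (allUpTo? (λ i → allUpTo? (P? i) k) n)
    where
    widen : (∀ {i} → i < n → ∀ {j} → j < k → P i j) → ∀ i j → P i j
    widen f i j with i <? n | j <? k
    ... | yes p | yes q = f p q
    ... | no ¬p | _     = lo i j (≮⇒≥ ¬p)
    ... | yes _ | no ¬q = hi i j (≮⇒≥ ¬q)

  boxed? : ∀ x → Dec (BoxedPP k n m (array x))
  boxed? x = map′
    (λ (c , r , z) → record
      { columns = c ; rows = r ; below = array-below x ; right = array-right x ; corner = z })
    (λ b → BoxedPP.columns b , BoxedPP.rows b , BoxedPP.corner b)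
    (box? (λ i j → array x (suc i , j) ≤? array x (i , j))
       (λ i j p → zero-≤ (array-below x (suc i) j (m≤n⇒m≤1+n p)))
       (λ i j p → zero-≤ (array-right x (suc i) j p))
     ×-dec box? (λ i j → array x (i , suc j) ≤? array x (i , j))
       (λ i j p → zero-≤ (array-below x i (suc j) p))
       (λ i j p → zero-≤ (array-right x i (suc j) (m≤n⇒m≤1+n p)))
     ×-dec (array x (0 , 0) ≤? m))
    where
    zero-≤ : ∀ {a b} → a ≡ 0 → a ≤ b
    zero-≤ refl = z≤n

  withDescents? : ∀ α x → Dec (PPWithDescents k n m α (array x))
  withDescents? α x with boxed? x
  ... | no ¬b = no λ (p , _) → ¬b (PP⇒Boxed p)
  ... | yes b = map′
    (λ eq → Boxed⇒PP b , λ i →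
      subst (λ c → Exactly c (IsDescent (array x) (suc (toℕ i)))) (eq i) (proj₂ (count i)))
    (λ (_ , d) i → HasSize-unique (proj₂ (count i)) (d i))
    (Finₚ.all? λ i → proj₁ (count i) ≟ α i)
    where
    count : (i : Fin m) → FinitelyMany (IsDescent (array x) (suc (toℕ i)))
    count i = BoxedPP.finitelyManyDescents b (toℕ i)

finite : ∀ k n m α → ∃ (HasSize arrays (PPWithDescents k n m α))
finite k n m α = sizeCovered arrays (PPWithDescents k n m α) (resp α)
  array array-inj (withDescents? α) (λ π (p , _) → cover π (PP⇒Boxed p))
  where open Enumeration k n m

D : (k n m : ℕ) → Vector ℕ m → ℕ
D k n m α = proj₁ (finite k n m α)

D-size : ∀ k n m α → HasSize arrays (PPWithDescents k n m α) (D k n m α)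
D-size k n m α = proj₂ (finite k n m α)

{-# OPTIONS --safe #-}
module Submission where

-- A plane partition with entries at most m is a chain of layers
-- c₁ ≥ … ≥ c_m ≥ c_{m+1} = 0, where c_i lists the column heights of the region
-- {π ≥ i}; entry i has as many descents as there are strict drops from c_i to
-- c_{i+1}. Both parts are thus local: with c_{i-1} = μ and c_{i+1} = ρ fixed,
-- the polynomial P(x, y) = Σ_ν x^{drops(μ, ν)} y^{drops(ν, ρ)}, over ν between
-- ρ and μ, has to be symmetric, with coefficients increasing towards the middle
-- of each antidiagonal. Building P column by column, let G(v) be the sum over
-- the ν with first entry at most v. Then
--   x G(v+1) - x G(v) - x y G(v+1) is symmetric for every v ≥ ρ₁,
-- and this relation for the remaining columns yields both itself and the
-- symmetry of P with one more column. In the unimodality, a new column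
-- contributes factors x, xy and one term y P' with P' symmetric: these
-- preserve the inequalities off the middle, where symmetry gives equality.
-- Finally, a dominated weakly decreasing α is reached from β by permutations and
-- by moving single units from larger to smaller entries.

open import Defs
open import Data.Empty using (⊥)
open import Data.Fin using (Fin; zero; suc; toℕ)
open import Data.Fin.Permutation using (Permutation′; _⟨$⟩ʳ_; _⟨$⟩ˡ_; inverseˡ; inverseʳ)
open import Data.List using
  ( List; []; _∷_; _++_; length; map; filter; cartesianProductWith; take; tabulate
  ; applyUpTo; lookup)
import Data.List.Properties as List
open import Data.List.Membership.Propositional using (_∈_)
open import Data.List.Membership.Propositional.Properties
open import Data.List.Membership.Propositional.Properties.WithK using (unique∧set⇒bag)
open import Data.List.Relation.Binary.BagAndSetEquality using (∼bag⇒↭)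
open import Data.List.Relation.Binary.Permutation.Propositional as Perm using (_↭_)
import Data.List.Relation.Binary.Permutation.Propositional.Properties as Perm
open import Data.List.Relation.Unary.All as All using (All; []; _∷_)
open import Data.List.Relation.Unary.AllPairs using (AllPairs; []; _∷_)
import Data.List.Relation.Unary.AllPairs.Properties as AllPairs
import Data.List.Relation.Unary.Any as Any
open import Data.List.Relation.Unary.Any using (here; there)
open import Data.List.Relation.Unary.Any.Properties using (lookup-index)
open import Data.List.Relation.Unary.Unique.Propositional using (Unique)
import Data.List.Relation.Unary.Unique.Propositional.Properties as Unique
open import Data.Nat
open import Data.Nat.ListAction using (sum)
open import Data.Nat.ListAction.Properties using (sum-++)
open import Data.Nat.Properties
open import Algebra.Properties.CommutativeSemigroup +-commutativeSemigroup using (interchange)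
open import Data.Nat.Solver using (module +-*-Solver)
open import Data.Product using (∃; _×_; _,_; proj₁; proj₂)
open import Data.Sum using (inj₁; inj₂)
open import Data.Vec as Vec using (Vec; []; _∷_; replicate)
open import Data.Vec.Functional using (Vector)
open import Data.Vec.Properties using (∷-injectiveʳ)
open import Function using (_∘_; const; mk⇔)
open import Level using (0ℓ)
open import Relation.Binary using (Setoid; tri<; tri≈; tri>)
open import Relation.Binary.PropositionalEquality
open import Relation.Nullary using (¬_; Dec; yes; no; contradiction)
open import Relation.Nullary.Decidable using (map′)
open import Relation.Unary using (Decidable)

private variable
  A B C : Set
  k : ℕ

-- Symmetry and unimodality of bivariate polynomials

-- p stands for the polynomial Σ p a b xᵃ yᵇ.
Poly : Set
Poly = ℕ → ℕ → ℕ

shift : (ℕ → ℕ) → ℕ → ℕ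
shift f zero    = 0
shift f (suc a) = f a

X Y : Poly → Poly
X p a b = shift (λ a → p a b) a
Y p a b = shift (p a) b

infixl 6 _⊕_
_⊕_ : Poly → Poly → Poly
(p ⊕ q) a b = p a b + q a b

𝟘 𝟙 : Poly
𝟘 _ _ = 0
𝟙 zero    zero    = 1
𝟙 zero    (suc _) = 0
𝟙 (suc _) _       = 0

infix 4 _≐_ _∼_
_≐_ : Poly → Poly → Set
p ≐ q = ∀ a b → p a b ≡ q a b

-- p − q is a symmetric polynomial, with the negative terms moved across.
record _∼_ (p q : Poly) : Set where
  field balance : ∀ a b → p a b + q b a ≡ p b a + q a b

open _∼_

X-cong : ∀ {p q} → p ≐ q → X p ≐ X q
X-cong e zero    b = refl
X-cong e (suc a) b = e a b

X-⊕ : ∀ p q → X (p ⊕ q) ≐ X p ⊕ X q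
X-⊕ p q zero    b = refl
X-⊕ p q (suc a) b = refl

≐⇒∼ : ∀ {p q} → p ≐ q → p ∼ q
balance (≐⇒∼ {p} {q} e) a b = begin
  p a b + q b a ≡⟨ cong₂ _+_ (e a b) (sym (e b a)) ⟩
  q a b + p b a ≡⟨ +-comm (q a b) _ ⟩
  p b a + q a b ∎
  where open ≡-Reasoning

∼-refl : ∀ {p} → p ∼ p
∼-refl = ≐⇒∼ λ _ _ → refl

∼-sym : ∀ {p q} → p ∼ q → q ∼ p
balance (∼-sym {p} {q} e) a b = begin
  q a b + p b a ≡⟨ +-comm (q a b) _ ⟩
  p b a + q a b ≡⟨ balance e a b ⟨
  p a b + q b a ≡⟨ +-comm (p a b) _ ⟩
  q b a + p a b ∎
  where open ≡-Reasoning

∼-trans : ∀ {p q r} → p ∼ q → q ∼ r → p ∼ r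
balance (∼-trans {p} {q} {r} e f) a b = +-cancelˡ-≡ (q a b + q b a) _ _ (begin
  (q a b + q b a) + (p a b + r b a) ≡⟨ rearrange (p a b) (q b a) (q a b) (r b a) ⟩
  (p a b + q b a) + (q a b + r b a) ≡⟨ cong₂ _+_ (balance e a b) (balance f a b) ⟩
  (p b a + q a b) + (q b a + r a b) ≡⟨ rearrange (p b a) (q a b) (q b a) (r a b) ⟨
  (q b a + q a b) + (p b a + r a b) ≡⟨ cong (_+ (p b a + r a b)) (+-comm (q b a) (q a b)) ⟩
  (q a b + q b a) + (p b a + r a b) ∎)
  where
  open ≡-Reasoning
  open +-*-Solver
  rearrange : ∀ s t u v → (u + t) + (s + v) ≡ (s + t) + (u + v)
  rearrange = solve 4 (λ s t u v → (u :+ t) :+ (s :+ v) := (s :+ t) :+ (u :+ v)) refl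

∼-⊕ : ∀ {p p′ q q′} → p ∼ p′ → q ∼ q′ → p ⊕ q ∼ p′ ⊕ q′
balance (∼-⊕ {p} {p′} {q} {q′} e f) a b = begin
  (p a b + q a b) + (p′ b a + q′ b a) ≡⟨ interchange (p a b) _ _ _ ⟩
  (p a b + p′ b a) + (q a b + q′ b a) ≡⟨ cong₂ _+_ (balance e a b) (balance f a b) ⟩
  (p b a + p′ a b) + (q b a + q′ a b) ≡⟨ interchange (p b a) _ _ _ ⟩
  (p b a + q b a) + (p′ a b + q′ a b) ∎
  where open ≡-Reasoning

-- The factor xy is invariant under exchanging x and y. The factor x is not, so `X` by itself
-- respects `≐` but not `∼`.
XY-∼ : ∀ {p q} → p ∼ q → X (Y p) ∼ X (Y q)
balance (XY-∼ e) zero    zero    = refl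
balance (XY-∼ e) zero    (suc b) = refl
balance (XY-∼ e) (suc a) zero    = refl
balance (XY-∼ e) (suc a) (suc b) = balance e a b

XY-∼𝟘 : ∀ {p} → p ∼ 𝟘 → X (Y p) ∼ 𝟘
balance (XY-∼𝟘 e) zero    zero    = refl
balance (XY-∼𝟘 e) zero    (suc b) = refl
balance (XY-∼𝟘 e) (suc a) zero    = refl
balance (XY-∼𝟘 e) (suc a) (suc b) = balance e a b

∼𝟘⇒symmetric : ∀ {p} → p ∼ 𝟘 → ∀ a b → p a b ≡ p b a
∼𝟘⇒symmetric e a b = +-cancelʳ-≡ 0 _ _ (balance e a b)

-- The factor x + y is symmetric.
X⊕Y-∼𝟘 : ∀ {p} → p ∼ 𝟘 → X p ⊕ Y p ∼ 𝟘
balance (X⊕Y-∼𝟘 {p} e) zero    zero    = refl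
balance (X⊕Y-∼𝟘 {p} e) (suc a) zero    = trans (+-identityʳ _) (balance e a 0)
balance (X⊕Y-∼𝟘 {p} e) zero    (suc b) = trans (balance e 0 b) (sym (+-identityʳ _))
balance (X⊕Y-∼𝟘 {p} e) (suc a) (suc b) = begin
  p a (suc b) + p (suc a) b + 0           ≡⟨ +-identityʳ _ ⟩
  p a (suc b) + p (suc a) b               ≡⟨ cong₂ _+_ (s a (suc b)) (s (suc a) b) ⟩
  p (suc b) a + p b (suc a)               ≡⟨ +-comm (p (suc b) a) _ ⟩
  p b (suc a) + p (suc b) a               ≡⟨ +-identityʳ _ ⟨
  p b (suc a) + p (suc b) a + 0           ∎
  where
  open ≡-Reasoning
  s : ∀ a b → p a b ≡ p b a
  s = ∼𝟘⇒symmetric e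

-- Symmetric summands are invisible to `∼`; this is how terms enter or leave a chain of
-- equivalences.
absorb : ∀ {p q} → q ∼ 𝟘 → p ∼ p ⊕ q
absorb {p} {q} e = ∼-trans (≐⇒∼ λ a b → sym (+-identityʳ (p a b))) (∼-⊕ (∼-refl {p}) (∼-sym e))

-- Along each antidiagonal the coefficients increase up to the middle.
Unimodal : Poly → Set
Unimodal p = ∀ a c → a ≤ c → p a (suc c) ≤ p (suc a) c

Unimodal-resp : ∀ {p q} → p ≐ q → Unimodal q → Unimodal p
Unimodal-resp e u a c a≤c = subst₂ _≤_ (sym (e _ _)) (sym (e _ _)) (u a c a≤c)

Unimodal-⊕ : ∀ {p q} → Unimodal p → Unimodal q → Unimodal (p ⊕ q)
Unimodal-⊕ u w a c a≤c = +-mono-≤ (u a c a≤c) (w a c a≤c)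

-- The inequality at (a + 1, c) comes from that of `p` at (a, c), whose side condition is weaker. A
-- factor y would need (a, c) for (a, c + 1), and the middle case a = c + 1 would be lost.
Unimodal-X : ∀ {p} → Unimodal p → Unimodal (X p)
Unimodal-X u zero    c a≤c = z≤n
Unimodal-X u (suc a) c a≤c = u a c (<⇒≤ a≤c)

Unimodal-XY : ∀ {p} → Unimodal p → Unimodal (X (Y p))
Unimodal-XY u zero    c       a≤c       = z≤n
Unimodal-XY u (suc a) (suc c) (s≤s a≤c) = u a c a≤c

-- Prepending one column

drop : ℕ → ℕ → (ℕ → ℕ) → ℕ → ℕ
drop u w f a with <-cmp u w
... | tri< _ _ _ = shift f a
... | tri≈ _ _ _ = f a
... | tri> _ _ _ = 0

drop-< : ∀ {u w} → u < w → ∀ f a → drop u w f a ≡ shift f a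
drop-< {u} {w} lt f a with <-cmp u w
... | tri< _ _ _ = refl
... | tri≈ ≮ _ _ = contradiction lt ≮
... | tri> ≮ _ _ = contradiction lt ≮

drop-≡ : ∀ u f a → drop u u f a ≡ f a
drop-≡ u f a with <-cmp u u
... | tri< _ ≢ _ = contradiction refl ≢
... | tri≈ _ _ _ = refl
... | tri> _ ≢ _ = contradiction refl ≢

drop-> : ∀ {u w} → u > w → ∀ f a → drop u w f a ≡ 0
drop-> {u} {w} gt f a with <-cmp u w
... | tri< _ _ ≯ = contradiction gt ≯
... | tri≈ _ _ ≯ = contradiction gt ≯
... | tri> _ _ _ = refl

drop-cong : ∀ u w {f g} → (∀ a → f a ≡ g a) → ∀ a → drop u w f a ≡ drop u w g a
drop-cong u w e a with <-cmp u w
drop-cong u w e zero    | tri< _ _ _ = refl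
drop-cong u w e (suc a) | tri< _ _ _ = e a
drop-cong u w e a       | tri≈ _ _ _ = e a
drop-cong u w e a       | tri> _ _ _ = refl

-- The weight of one column in passing from height `w` to height `u`: the variable for a strict
-- drop, 1 for equality, 0 if the next layer would stick out. `dropX` records the drop from μ to ν,
-- `dropY` that from ν to ρ.
dropX dropY : ℕ → ℕ → Poly → Poly
dropX u w p a b = drop u w (λ a → p a b) a
dropY u w p a b = drop u w (p a) b

sumTo : ℕ → (ℕ → Poly) → Poly
sumTo zero    t = t 0
sumTo (suc v) t = sumTo v t ⊕ t (suc v)

-- In the application S v enumerates the decreasing ν with ρ ≤ ν ≤ μ and first
-- entry at most v, where r and m bound the first entries of ρ and μ. For v < m
-- it is not symmetric; step is the remnant of symmetry that makes the
-- induction on the number of columns work.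
record Regular (r m : ℕ) (S : ℕ → Poly) : Set where
  field
    step      : ∀ v → r ≤ v → X (S (suc v)) ∼ X (S v) ⊕ X (Y (S (suc v)))
    symmetric : ∀ v → m ≤ v → S v ∼ 𝟘
    unimodal  : ∀ v → Unimodal (S v)

Regular-weaken : ∀ {r m r′ m′ S} → r ≤ r′ → m ≤ m′ → Regular r m S → Regular r′ m′ S
Regular-weaken r≤ m≤ R = record
  { step      = λ v le → step v (≤-trans r≤ le)
  ; symmetric = λ v le → symmetric v (≤-trans m≤ le)
  ; unimodal  = unimodal
  }
  where open Regular R

𝟙-symmetric : 𝟙 ∼ 𝟘
balance 𝟙-symmetric zero    zero    = refl
balance 𝟙-symmetric zero    (suc b) = refl
balance 𝟙-symmetric (suc a) zero    = refl
balance 𝟙-symmetric (suc a) (suc b) = refl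

-- Without columns there is only the empty ν. The enumerator does not depend on v, so `step` reduces
-- to the symmetry of xy.
Regular-𝟙 : Regular 0 0 (λ _ → 𝟙)
Regular-𝟙 = record
  { step      = λ _ _ → absorb {X 𝟙} (XY-∼𝟘 𝟙-symmetric)
  ; symmetric = λ _ _ → 𝟙-symmetric
  ; unimodal  = λ { _ zero c _ → z≤n ; _ (suc a) c _ → z≤n }
  }

-- The induction step. `S` enumerates the remaining columns, where the entries of the two outer
-- layers are bounded by the new first entries `ρ` and `μ`. A ν with first entry `u` continues with
-- entries at most `u`, so it contributes `S u` times the weight of the first column.
module Column (ρ μ : ℕ) (S : ℕ → Poly) (R : Regular ρ μ S) where
  open Regular R

  t : ℕ → Poly
  t u = dropX u μ (dropY ρ u (S u))

  S⁺ : ℕ → Poly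
  S⁺ v = sumTo v t

  t-below : ∀ {u} → u < ρ → t u ≐ 𝟘
  t-below {u} u<ρ a b with <-cmp u μ
  t-below {u} u<ρ zero    b | tri< _ _ _ = refl
  t-below {u} u<ρ (suc a) b | tri< _ _ _ = drop-> u<ρ (S u a) b
  t-below {u} u<ρ a       b | tri≈ _ _ _ = drop-> u<ρ (S u a) b
  t-below {u} u<ρ a       b | tri> _ _ _ = refl

  t-above : ∀ {u} → μ < u → t u ≐ 𝟘
  t-above μ<u a b = drop-> μ<u _ a

  t-empty : μ < ρ → ∀ u → t u ≐ 𝟘
  t-empty μ<ρ u with u <? ρ
  ... | yes u<ρ = t-below u<ρ
  ... | no  u≮ρ = t-above (<-≤-trans μ<ρ (≮⇒≥ u≮ρ))

  t-bottom : ρ < μ → t ρ ≐ X (S ρ)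
  t-bottom ρ<μ a b = trans (drop-< ρ<μ _ a) (X-cong (λ a → drop-≡ ρ (S ρ a)) a b)

  t-middle : ∀ {u} → ρ < u → u < μ → t u ≐ X (Y (S u))
  t-middle {u} ρ<u u<μ a b =
    trans (drop-< u<μ _ a) (X-cong (λ a → drop-< ρ<u (S u a)) a b)

  t-top : ρ < μ → t μ ≐ Y (S μ)
  t-top ρ<μ a b = trans (drop-≡ μ _ a) (drop-< ρ<μ (S μ a) b)

  t-only : ρ ≡ μ → t μ ≐ S μ
  t-only refl a b = trans (drop-≡ μ _ a) (drop-≡ μ (S μ a) b)

  S⁺-zero : ∀ v → (∀ u → u ≤ v → t u ≐ 𝟘) → S⁺ v ≐ 𝟘
  S⁺-zero zero    h a b = h 0 z≤n a b
  S⁺-zero (suc v) h a b =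
    cong₂ _+_ (S⁺-zero v (λ u le → h u (m≤n⇒m≤1+n le)) a b) (h (suc v) ≤-refl a b)

  S⁺-at : ∀ u → u ≤ ρ → S⁺ u ≐ t u
  S⁺-at zero    u≤ρ a b = refl
  S⁺-at (suc u) u≤ρ a b =
    cong (_+ t (suc u) a b) (S⁺-zero u (λ _ le → t-below (≤-<-trans le u≤ρ)) a b)

  S⁺-stable : ∀ v → μ ≤ v → S⁺ v ≐ S⁺ μ
  S⁺-stable v μ≤v with m≤n⇒m<n∨m≡n μ≤v
  ... | inj₂ refl = λ _ _ → refl
  S⁺-stable (suc v) _ | inj₁ (s≤s μ≤v) = λ a b → begin
    S⁺ v a b + t (suc v) a b ≡⟨ cong₂ _+_ (S⁺-stable v μ≤v a b) (t-above (s≤s μ≤v) a b) ⟩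
    S⁺ μ a b + 0             ≡⟨ +-identityʳ _ ⟩
    S⁺ μ a b                 ∎
    where open ≡-Reasoning

  -- Telescoping: the sum is x S(ρ) + xy S(ρ+1) + ... + xy S(w), and by `step` each xy S(u+1) equals
  -- x S(u+1) - x S(u) up to a symmetric polynomial.
  S⁺∼XS : ∀ w → ρ ≤ w → w < μ → S⁺ w ∼ X (S w)
  S⁺∼XS w ρ≤w w<μ with m≤n⇒m<n∨m≡n ρ≤w
  ... | inj₂ refl = ≐⇒∼ λ a b → trans (S⁺-at w ≤-refl a b) (t-bottom w<μ a b)
  S⁺∼XS (suc w) ρ≤w w<μ | inj₁ (s≤s ρ≤w′) =
    ∼-trans (∼-⊕ (S⁺∼XS w ρ≤w′ (<⇒≤ w<μ)) (≐⇒∼ (t-middle (s≤s ρ≤w′) w<μ)))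
            (∼-sym (step w ρ≤w′))

  S⁺-top : ∀ {v} → ρ ≤ v → suc v ≡ μ → S⁺ μ ≐ S⁺ v ⊕ Y (S μ)
  S⁺-top {v} ρ≤v refl a b = cong (S⁺ v a b +_) (t-top (s≤s ρ≤v) a b)

  -- For ρ < μ = v + 1 the sum is S⁺(v) + y S(μ). Here S⁺(v) ∼ x S(v) ∼ x S(μ), the last by `step`
  -- because xy S(μ) is symmetric; the total is equivalent to (x + y) S(μ).
  S⁺-μ-symmetric : S⁺ μ ∼ 𝟘
  S⁺-μ-symmetric with <-cmp ρ μ
  ... | tri> _ _ μ<ρ = ≐⇒∼ (S⁺-zero μ (λ u _ → t-empty μ<ρ u))
  ... | tri≈ _ ρ≡μ _ = ∼-trans
    (≐⇒∼ λ a b → trans (S⁺-at μ (≤-reflexive (sym ρ≡μ)) a b) (t-only ρ≡μ a b))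
    (symmetric μ ≤-refl)
  ... | tri< ρ<μ _ _ = top μ refl ρ<μ
    where
    top : ∀ w → w ≡ μ → ρ < w → S⁺ μ ∼ 𝟘
    top (suc v) eq (s≤s ρ≤v) = ∼-trans (≐⇒∼ (S⁺-top ρ≤v eq)) (∼-trans
      (∼-⊕ S⁺v∼XSμ (∼-refl {Y (S μ)}))
      (X⊕Y-∼𝟘 (symmetric μ ≤-refl)))
      where
      S⁺v∼XSμ : S⁺ v ∼ X (S μ)
      S⁺v∼XSμ = ∼-trans (S⁺∼XS v ρ≤v (≤-reflexive eq)) (∼-trans
        (absorb {X (S v)} (XY-∼𝟘 (symmetric (suc v) (≤-reflexive (sym eq)))))
        (subst (λ w → X (S v) ⊕ X (Y (S (suc v))) ∼ X (S w)) eq (∼-sym (step v ρ≤v))))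

  S⁺-symmetric : ∀ v → μ ≤ v → S⁺ v ∼ 𝟘
  S⁺-symmetric v μ≤v = ∼-trans (≐⇒∼ (S⁺-stable v μ≤v)) S⁺-μ-symmetric

  -- After removing x S⁺(v) from both sides, x t(v+1) ∼ xy S⁺(v+1) remains. Below μ both are
  -- equivalent to x · xy S(v+1), by `S⁺∼XS`; at μ both are symmetric; beyond μ the sum is constant
  -- and symmetric.
  S⁺-step : ∀ v → ρ ≤ v → X (S⁺ (suc v)) ∼ X (S⁺ v) ⊕ X (Y (S⁺ (suc v)))
  S⁺-step v ρ≤v with <-cmp μ (suc v)
  ... | tri> _ _ v+1<μ = ∼-trans (≐⇒∼ (X-⊕ (S⁺ v) (t (suc v)))) (∼-⊕ (∼-refl {X (S⁺ v)}) (∼-trans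
    (≐⇒∼ λ a b → trans (X-cong (t-middle (s≤s ρ≤v) v+1<μ) a b) (XXY≐XYX (S (suc v)) a b))
    (XY-∼ (∼-sym (S⁺∼XS (suc v) (m≤n⇒m≤1+n ρ≤v) v+1<μ)))))
    where
    XXY≐XYX : ∀ p → X (X (Y p)) ≐ X (Y (X p))
    XXY≐XYX p zero          b       = refl
    XXY≐XYX p (suc zero)    zero    = refl
    XXY≐XYX p (suc zero)    (suc b) = refl
    XXY≐XYX p (suc (suc a)) zero    = refl
    XXY≐XYX p (suc (suc a)) (suc b) = refl
  ... | tri≈ _ refl _ = ∼-trans (≐⇒∼ (X-⊕ (S⁺ v) (t (suc v)))) (∼-⊕ (∼-refl {X (S⁺ v)}) (∼-trans
    (≐⇒∼ (X-cong (t-top (s≤s ρ≤v))))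
    (∼-trans (XY-∼𝟘 (symmetric μ ≤-refl)) (∼-sym (XY-∼𝟘 S⁺-μ-symmetric)))))
  ... | tri< (s≤s μ≤v) _ _ = ∼-trans
    (≐⇒∼ (X-cong λ a b → trans (S⁺-stable (suc v) (m≤n⇒m≤1+n μ≤v) a b) (sym (S⁺-stable v μ≤v a b))))
    (absorb {X (S⁺ v)} (XY-∼𝟘 (S⁺-symmetric (suc v) (m≤n⇒m≤1+n μ≤v))))

  𝟘-unimodal : Unimodal 𝟘
  𝟘-unimodal _ _ _ = z≤n

  -- Below μ only the weights x, xy and 0 occur; the weight y, which can break unimodality, first
  -- appears at u = μ.
  t-unimodal : ∀ u → u < μ → Unimodal (t u)
  t-unimodal u u<μ with <-cmp u ρ
  ... | tri> _ _ ρ<u  = Unimodal-resp (t-middle ρ<u u<μ) (Unimodal-XY (unimodal u))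
  ... | tri≈ _ refl _ = Unimodal-resp (t-bottom u<μ) (Unimodal-X (unimodal u))
  ... | tri< u<ρ _ _  = Unimodal-resp (t-below u<ρ) 𝟘-unimodal

  S⁺-below-unimodal : ∀ v → v < μ → Unimodal (S⁺ v)
  S⁺-below-unimodal zero    v<μ = t-unimodal 0 v<μ
  S⁺-below-unimodal (suc v) v<μ =
    Unimodal-⊕ {S⁺ v} {t (suc v)} (S⁺-below-unimodal v (<⇒≤ v<μ)) (t-unimodal (suc v) v<μ)

  -- Off the middle, Y preserves the inequality; at the middle, symmetry of the
  -- whole sum makes it an equality.
  S⁺-μ-unimodal : Unimodal (S⁺ μ)
  S⁺-μ-unimodal with <-cmp ρ μ
  ... | tri> _ _ μ<ρ = Unimodal-resp (S⁺-zero μ (λ u _ → t-empty μ<ρ u)) 𝟘-unimodal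
  ... | tri≈ _ ρ≡μ _ = Unimodal-resp
    (λ a b → trans (S⁺-at μ (≤-reflexive (sym ρ≡μ)) a b) (t-only ρ≡μ a b)) (unimodal μ)
  ... | tri< ρ<μ _ _ = top μ refl ρ<μ
    where
    top : ∀ w → w ≡ μ → ρ < w → Unimodal (S⁺ μ)
    top (suc v) eq (s≤s ρ≤v) a c a≤c with m≤n⇒m<n∨m≡n a≤c
    ... | inj₂ refl = ≤-reflexive (∼𝟘⇒symmetric S⁺-μ-symmetric a (suc a))
    top (suc v) eq (s≤s ρ≤v) a (suc c) _ | inj₁ (s≤s a≤c) =
      subst₂ _≤_ (sym (S⁺-top ρ≤v eq _ _)) (sym (S⁺-top ρ≤v eq _ _))
        (+-mono-≤ (S⁺-below-unimodal v (≤-reflexive eq) a (suc c) (m≤n⇒m≤1+n a≤c))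
                  (unimodal μ a c a≤c))

  S⁺-unimodal : ∀ v → Unimodal (S⁺ v)
  S⁺-unimodal v with v <? μ
  ... | yes v<μ = S⁺-below-unimodal v v<μ
  ... | no  v≮μ = Unimodal-resp (S⁺-stable v (≮⇒≥ v≮μ)) S⁺-μ-unimodal

  Regular-S⁺ : Regular ρ μ S⁺
  Regular-S⁺ = record { step = S⁺-step ; symmetric = S⁺-symmetric ; unimodal = S⁺-unimodal }

-- Finite sums

∑ : List A → (A → ℕ) → ℕ
∑ xs f = sum (map f xs)

∑-++ : ∀ (xs ys : List A) f → ∑ (xs ++ ys) f ≡ ∑ xs f + ∑ ys f
∑-++ xs ys f = trans (cong sum (List.map-++ f xs ys)) (sum-++ (map f xs) _)

∑-map : ∀ (h : A → B) xs f → ∑ (map h xs) f ≡ ∑ xs (f ∘ h)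
∑-map h xs f = cong sum (sym (List.map-∘ xs))

∑-mono : ∀ (xs : List A) {f g} → (∀ {x} → x ∈ xs → f x ≤ g x) → ∑ xs f ≤ ∑ xs g
∑-mono []       h = z≤n
∑-mono (x ∷ xs) h = +-mono-≤ (h (here refl)) (∑-mono xs (h ∘ there))

∑-cong : ∀ (xs : List A) {f g} → (∀ {x} → x ∈ xs → f x ≡ g x) → ∑ xs f ≡ ∑ xs g
∑-cong xs h = ≤-antisym (∑-mono xs (≤-reflexive ∘ h)) (∑-mono xs (≤-reflexive ∘ sym ∘ h))

∑-zero : ∀ (xs : List A) → ∑ xs (const 0) ≡ 0
∑-zero []       = refl
∑-zero (x ∷ xs) = ∑-zero xs

∑-* : ∀ (xs : List A) c f → c * ∑ xs f ≡ ∑ xs (λ x → c * f x)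
∑-* []       c f = *-zeroʳ c
∑-* (x ∷ xs) c f = trans (*-distribˡ-+ c (f x) _) (cong (c * f x +_) (∑-* xs c f))

∑-+ : ∀ (xs : List A) f g → ∑ xs (λ x → f x + g x) ≡ ∑ xs f + ∑ xs g
∑-+ []       f g = refl
∑-+ (x ∷ xs) f g = trans (cong (f x + g x +_) (∑-+ xs f g)) (interchange (f x) _ _ _)

∑-swap : ∀ (xs : List A) (ys : List B) (f : A → B → ℕ) →
         ∑ xs (λ x → ∑ ys (f x)) ≡ ∑ ys (λ y → ∑ xs (λ x → f x y))
∑-swap []       ys f = sym (∑-zero ys)
∑-swap (x ∷ xs) ys f = trans (cong (∑ ys (f x) +_) (∑-swap xs ys f)) (sym (∑-+ ys _ _))

∑-cartesianProductWith : ∀ (h : A → B → C) xs ys f →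
  ∑ (cartesianProductWith h xs ys) f ≡ ∑ xs (λ x → ∑ ys (λ y → f (h x y)))
∑-cartesianProductWith h []       ys f = refl
∑-cartesianProductWith h (x ∷ xs) ys f = trans (∑-++ (map (h x) ys) _ f)
  (cong₂ _+_ (∑-map (h x) ys f) (∑-cartesianProductWith h xs ys f))

∑-1 : ∀ (xs : List A) → ∑ xs (const 1) ≡ length xs
∑-1 []       = refl
∑-1 (x ∷ xs) = cong suc (∑-1 xs)

indicator : {P : Set} → Dec P → ℕ
indicator (yes _) = 1
indicator (no  _) = 0

indicator-cong : {P Q : Set} (p : Dec P) (q : Dec Q) → (P → Q) → (Q → P) →
                 indicator p ≡ indicator q
indicator-cong (yes p) (yes q) f g = refl
indicator-cong (yes p) (no ¬q) f g = contradiction (f p) ¬q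
indicator-cong (no ¬p) (yes q) f g = contradiction (g q) ¬p
indicator-cong (no ¬p) (no ¬q) f g = refl

∑-filter : ∀ {P : A → Set} (P? : Decidable P) xs f →
           ∑ (filter P? xs) f ≡ ∑ xs (λ x → indicator (P? x) * f x)
∑-filter P? []       f = refl
∑-filter P? (x ∷ xs) f with P? x
... | yes _ = cong₂ _+_ (sym (+-identityʳ (f x))) (∑-filter P? xs f)
... | no  _ = ∑-filter P? xs f

-- Chains of layers and their counts

data Decreasing : ℕ → Vec ℕ k → Set where
  []  : ∀ {v} → Decreasing v []
  _∷_ : ∀ {u v} {us : Vec ℕ k} → u ≤ v → Decreasing u us → Decreasing v (u ∷ us)

-- The recursion on the bound follows that of `sumTo`, so that sums over this list unfold into
-- `between`.
decreasing : ∀ k → ℕ → List (Vec ℕ k)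
decreasing zero    v       = [] ∷ []
decreasing (suc k) zero    = map (0 ∷_) (decreasing k 0)
decreasing (suc k) (suc v) = decreasing (suc k) v ++ map (suc v ∷_) (decreasing k (suc v))

Decreasing-weaken : ∀ {u v} {us : Vec ℕ k} → u ≤ v → Decreasing u us → Decreasing v us
Decreasing-weaken u≤v []         = []
Decreasing-weaken u≤v (le ∷ ds) = ≤-trans le u≤v ∷ ds

∈-decreasing⁻ : ∀ k v {us} → us ∈ decreasing k v → Decreasing v us
∈-decreasing⁻ zero    v       (here refl) = []
∈-decreasing⁻ (suc k) zero    us∈ with ∈-map⁻ (0 ∷_) us∈
... | _ , ws∈ , refl = z≤n ∷ ∈-decreasing⁻ k 0 ws∈
∈-decreasing⁻ (suc k) (suc v) us∈ with ∈-++⁻ (decreasing (suc k) v) us∈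
... | inj₁ us∈′ = Decreasing-weaken (n≤1+n v) (∈-decreasing⁻ (suc k) v us∈′)
... | inj₂ us∈′ with ∈-map⁻ (suc v ∷_) us∈′
...   | _ , ws∈ , refl = ≤-refl ∷ ∈-decreasing⁻ k (suc v) ws∈

∈-decreasing⁺ : ∀ {k} v {us : Vec ℕ k} → Decreasing v us → us ∈ decreasing k v
∈-decreasing⁺ v       []         = here refl
∈-decreasing⁺ zero    (z≤n ∷ ds) = ∈-map⁺ (0 ∷_) (∈-decreasing⁺ 0 ds)
∈-decreasing⁺ (suc v) (le ∷ ds) with m≤n⇒m<n∨m≡n le
... | inj₁ (s≤s u≤v) = ∈-++⁺ˡ (∈-decreasing⁺ v (u≤v ∷ ds))
... | inj₂ refl      = ∈-++⁺ʳ (decreasing _ v) (∈-map⁺ (suc v ∷_) (∈-decreasing⁺ (suc v) ds))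

decreasing-unique : ∀ k v → Unique (decreasing k v)
decreasing-unique zero    v       = All.[] AllPairs.∷ AllPairs.[]
decreasing-unique (suc k) zero    = Unique.map⁺ ∷-injectiveʳ (decreasing-unique k 0)
decreasing-unique (suc k) (suc v) = Unique.++⁺ (decreasing-unique (suc k) v)
  (Unique.map⁺ ∷-injectiveʳ (decreasing-unique k (suc v))) disjoint
  where
  disjoint : ∀ {us} → us ∈ decreasing (suc k) v × us ∈ map (suc v ∷_) (decreasing k (suc v)) → ⊥
  disjoint (us∈ , us∈′) with ∈-map⁻ (suc v ∷_) us∈′
  ... | _ , _ , refl with ∈-decreasing⁻ (suc k) v us∈
  ...   | v<v ∷ _ = <-irrefl refl v<v

-- Step a μ ν: ν ≤ μ entrywise, with strict inequality in a positions.
data Step : ℕ → Vec ℕ k → Vec ℕ k → Set where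
  []    : Step 0 [] []
  keep  : ∀ {a u} {us ws : Vec ℕ k} → Step a us ws → Step a (u ∷ us) (u ∷ ws)
  lower : ∀ {a u w} {us ws : Vec ℕ k} → w < u → Step a us ws → Step (suc a) (u ∷ us) (w ∷ ws)

keep⁻ : ∀ {a u} {us ws : Vec ℕ k} → Step a (u ∷ us) (u ∷ ws) → Step a us ws
keep⁻ (keep s)      = s
keep⁻ (lower u<u s) = contradiction u<u (<-irrefl refl)

lower⁻ : ∀ {a u w} {us ws : Vec ℕ k} → w < u → Step (suc a) (u ∷ us) (w ∷ ws) → Step a us ws
lower⁻ w<u (keep s)    = contradiction w<u (<-irrefl refl)
lower⁻ w<u (lower _ s) = s

Step-≤ : ∀ {a u w} {us ws : Vec ℕ k} → Step a (u ∷ us) (w ∷ ws) → w ≤ u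
Step-≤ (keep s)      = ≤-refl
Step-≤ (lower w<u s) = <⇒≤ w<u

¬lower-zero : ∀ {u w} {us ws : Vec ℕ k} → w < u → ¬ Step 0 (u ∷ us) (w ∷ ws)
¬lower-zero w<u (keep s) = <-irrefl refl w<u

step? : ∀ a (us ws : Vec ℕ k) → Dec (Step a us ws)
step? a       []       []       = map′ (λ { refl → [] }) (λ { [] → refl }) (a ≟ 0)
step? a       (u ∷ us) (w ∷ ws) with <-cmp w u
step? zero    (u ∷ us) (w ∷ ws) | tri< w<u _ _ = no (¬lower-zero w<u)
step? (suc a) (u ∷ us) (w ∷ ws) | tri< w<u _ _ = map′ (lower w<u) (lower⁻ w<u) (step? a us ws)
step? a       (u ∷ us) (w ∷ ws) | tri≈ _ refl _ = map′ keep keep⁻ (step? a us ws)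
step? a       (u ∷ us) (w ∷ ws) | tri> _ _ u<w = no λ s → <⇒≱ u<w (Step-≤ s)

-- As a function of `a`, the coefficients of the monomial whose exponent is the number of strict
-- drops, or of 0 if `ws` is not contained in `us`.
steps : Vec ℕ k → Vec ℕ k → ℕ → ℕ
steps us ws a = indicator (step? a us ws)

steps-∷ : ∀ u (us : Vec ℕ k) w ws a → steps (u ∷ us) (w ∷ ws) a ≡ drop w u (steps us ws) a
steps-∷ u us w ws a with <-cmp w u
steps-∷ u us w ws zero    | tri< w<u _ _  = refl
steps-∷ u us w ws (suc a) | tri< w<u _ _  =
  indicator-cong (map′ (lower w<u) (lower⁻ w<u) (step? a us ws)) _ (lower⁻ w<u) (lower w<u)
steps-∷ u us w ws a       | tri≈ _ refl _ =
  indicator-cong (map′ keep keep⁻ (step? a us ws)) _ keep⁻ keep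
steps-∷ u us w ws a       | tri> _ _ _    = refl

-- The generating function, by numbers of strict drops, of the decreasing ν
-- with first entry at most v and ρ ≤ ν ≤ μ.
between : Vec ℕ k → Vec ℕ k → ℕ → Poly
between []       []       v = 𝟙
between (μ ∷ μs) (ρ ∷ ρs) v = sumTo v λ u → dropX u μ (dropY ρ u (between μs ρs u))

Regular-between : ∀ {r m} {μ ρ : Vec ℕ k} → Decreasing r ρ → Decreasing m μ →
                  Regular r m (between μ ρ)
Regular-between {μ = []}     {[]}     []        []        = Regular-weaken z≤n z≤n Regular-𝟙
Regular-between {μ = μ ∷ μs} {ρ ∷ ρs} (ρ≤ ∷ dρ) (μ≤ ∷ dμ) =
  Regular-weaken ρ≤ μ≤ (Column.Regular-S⁺ ρ μ (between μs ρs) (Regular-between dρ dμ))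

∑-dropˡ : ∀ u w (xs : List A) (h : A → ℕ → ℕ) (c : A → ℕ) a →
  ∑ xs (λ x → drop u w (h x) a * c x) ≡ drop u w (λ a → ∑ xs (λ x → h x a * c x)) a
∑-dropˡ u w xs h c a with <-cmp u w
∑-dropˡ u w xs h c zero    | tri< _ _ _ = ∑-zero xs
∑-dropˡ u w xs h c (suc a) | tri< _ _ _ = refl
∑-dropˡ u w xs h c a       | tri≈ _ _ _ = refl
∑-dropˡ u w xs h c a       | tri> _ _ _ = ∑-zero xs

∑-dropʳ : ∀ u w (xs : List A) (c : A → ℕ) (h : A → ℕ → ℕ) b →
  ∑ xs (λ x → c x * drop u w (h x) b) ≡ drop u w (λ b → ∑ xs (λ x → c x * h x b)) b
∑-dropʳ u w xs c h b = begin
  ∑ xs (λ x → c x * drop u w (h x) b)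
    ≡⟨ ∑-cong xs (λ {x} _ → *-comm (c x) _) ⟩
  ∑ xs (λ x → drop u w (h x) b * c x)
    ≡⟨ ∑-dropˡ u w xs h c b ⟩
  drop u w (λ b → ∑ xs (λ x → h x b * c x)) b
    ≡⟨ drop-cong u w (λ b → ∑-cong xs (λ {x} _ → *-comm (h x b) _)) b ⟩
  drop u w (λ b → ∑ xs (λ x → c x * h x b)) b ∎
  where open ≡-Reasoning

-- Each ν contributes one monomial in x and y. Its first entry is split off, and the two weights of
-- the first column, being linear, leave the sum over the remaining entries.
∑-steps : ∀ (μ ρ : Vec ℕ k) v a b →
          ∑ (decreasing k v) (λ ν → steps μ ν a * steps ν ρ b) ≡ between μ ρ v a b
∑-steps [] [] v zero    zero    = refl
∑-steps [] [] v zero    (suc b) = refl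
∑-steps [] [] v (suc a) b       = refl
∑-steps {suc k} (μ ∷ μs) (ρ ∷ ρs) v a b = sum-to v
  where
  open ≡-Reasoning
  column : ℕ → Poly
  column u = dropX u μ (dropY ρ u (between μs ρs u))
  f : Vec ℕ (suc k) → ℕ
  f ν = steps (μ ∷ μs) ν a * steps ν (ρ ∷ ρs) b
  sum-column : ∀ u → ∑ (map (u ∷_) (decreasing k u)) f ≡ column u a b
  sum-column u = begin
    ∑ (map (u ∷_) νs) f
      ≡⟨ ∑-map (u ∷_) νs f ⟩
    ∑ νs (λ ν → f (u ∷ ν))
      ≡⟨ ∑-cong νs (λ {ν} _ → cong₂ _*_ (steps-∷ μ μs u ν a) (steps-∷ u ν ρ ρs b)) ⟩
    ∑ νs (λ ν → drop u μ (steps μs ν) a * drop ρ u (steps ν ρs) b)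
      ≡⟨ ∑-dropˡ u μ νs (steps μs) (λ ν → drop ρ u (steps ν ρs) b) a ⟩
    drop u μ (λ a → ∑ νs (λ ν → steps μs ν a * drop ρ u (steps ν ρs) b)) a
      ≡⟨ drop-cong u μ (λ a → trans
           (∑-dropʳ ρ u νs (λ ν → steps μs ν a) (λ ν → steps ν ρs) b)
           (drop-cong ρ u (∑-steps μs ρs u a) b)) a ⟩
    column u a b ∎
    where
    νs = decreasing k u
  sum-to : ∀ v → ∑ (decreasing (suc k) v) f ≡ sumTo v column a b
  sum-to zero    = sum-column zero
  sum-to (suc v) = begin
    ∑ (decreasing (suc k) v ++ map (suc v ∷_) (decreasing k (suc v))) f
      ≡⟨ ∑-++ (decreasing (suc k) v) _ f ⟩
    ∑ (decreasing (suc k) v) f + ∑ (map (suc v ∷_) (decreasing k (suc v))) f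
      ≡⟨ cong₂ _+_ (sum-to v) (sum-column (suc v)) ⟩
    sumTo v column a b + column (suc v) a b ∎

module Layers (k n : ℕ) where

  Layer : Set
  Layer = Vec ℕ k

  layers : List Layer
  layers = decreasing k n

  empty : Layer
  empty = replicate k 0

  empty-decreasing : Decreasing n empty
  empty-decreasing = go k n
    where
    go : ∀ k v → Decreasing v (replicate k 0)
    go zero    v = []
    go (suc k) v = z≤n ∷ go k 0

  -- A transfer operator on functions of layers. `count` is a product of such operators, so
  -- permuting `α` amounts to commuting two of them.
  extend : ℕ → (Layer → ℕ) → Layer → ℕ
  extend a g ρ = ∑ layers λ μ → steps μ ρ a * g μ

  -- The sum of g μ₁ over the chains of layers μ₁ ≥ μ₂ ≥ … ≥ empty whose
  -- consecutive numbers of drops are the given ones.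
  count : List ℕ → (Layer → ℕ) → ℕ
  count []      g = g empty
  count (a ∷ α) g = count α (extend a g)

  -- Comparing on decreasing layers suffices because the sum runs over these; `extend-comm` and
  -- `extend-transfer` are available for decreasing ρ only.
  extend-mono : ∀ a {g h} → (∀ μ → Decreasing n μ → g μ ≤ h μ) →
                ∀ ρ → extend a g ρ ≤ extend a h ρ
  extend-mono a le ρ = ∑-mono layers λ {μ} μ∈ →
    *-monoʳ-≤ (steps μ ρ a) (le μ (∈-decreasing⁻ k n μ∈))

  count-mono : ∀ α {g h} → (∀ μ → Decreasing n μ → g μ ≤ h μ) → count α g ≤ count α h
  count-mono []      le = le empty empty-decreasing
  count-mono (a ∷ α) le = count-mono α λ ρ _ → extend-mono a le ρ

  count-cong : ∀ α {g h} → (∀ μ → Decreasing n μ → g μ ≡ h μ) → count α g ≡ count α h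
  count-cong α eq = ≤-antisym (count-mono α λ μ d → ≤-reflexive (eq μ d))
                              (count-mono α λ μ d → ≤-reflexive (sym (eq μ d)))

  -- Summing out the middle layer ν leaves the kernel `between μ ρ n a b`, which turns statements
  -- about the two drop numbers into statements about coefficients.
  extend² : ∀ a b g ρ → extend b (extend a g) ρ ≡ ∑ layers λ μ → g μ * between μ ρ n a b
  extend² a b g ρ = begin
    ∑ layers (λ ν → steps ν ρ b * ∑ layers (λ μ → steps μ ν a * g μ))
      ≡⟨ ∑-cong layers (λ {ν} _ → ∑-* layers (steps ν ρ b) _) ⟩
    ∑ layers (λ ν → ∑ layers (λ μ → steps ν ρ b * (steps μ ν a * g μ)))
      ≡⟨ ∑-swap layers layers _ ⟩
    ∑ layers (λ μ → ∑ layers (λ ν → steps ν ρ b * (steps μ ν a * g μ)))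
      ≡⟨ ∑-cong layers (λ {μ} _ → trans
           (∑-cong layers (λ {ν} _ → rearrange (steps ν ρ b) (steps μ ν a) (g μ)))
           (sym (∑-* layers (g μ) _))) ⟩
    ∑ layers (λ μ → g μ * ∑ layers (λ ν → steps μ ν a * steps ν ρ b))
      ≡⟨ ∑-cong layers (λ {μ} _ → cong (g μ *_) (∑-steps μ ρ n a b)) ⟩
    ∑ layers (λ μ → g μ * between μ ρ n a b) ∎
    where
    open ≡-Reasoning
    rearrange : ∀ x y z → x * (y * z) ≡ z * (y * x)
    rearrange x y z = begin
      x * (y * z) ≡⟨ *-comm x _ ⟩
      y * z * x   ≡⟨ cong (_* x) (*-comm y z) ⟩
      z * y * x   ≡⟨ *-assoc z y x ⟩
      z * (y * x) ∎

  extend-comm : ∀ a b g ρ → Decreasing n ρ → extend b (extend a g) ρ ≡ extend a (extend b g) ρ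
  extend-comm a b g ρ dρ = begin
    extend b (extend a g) ρ
      ≡⟨ extend² a b g ρ ⟩
    ∑ layers (λ μ → g μ * between μ ρ n a b)
      -- The entries of μ are at most n, so the bound n on ν already lies in the range where
      -- `symmetric` applies.
      ≡⟨ ∑-cong layers (λ {μ} μ∈ → cong (g μ *_)
           (∼𝟘⇒symmetric (Regular.symmetric (regular μ∈) n ≤-refl) a b)) ⟩
    ∑ layers (λ μ → g μ * between μ ρ n b a)
      ≡⟨ extend² b a g ρ ⟨
    extend a (extend b g) ρ ∎
    where
    open ≡-Reasoning
    regular : ∀ {μ} → μ ∈ layers → Regular n n (between μ ρ)
    regular μ∈ = Regular-between dρ (∈-decreasing⁻ k n μ∈)

  extend-transfer : ∀ {a c} → a ≤ c → ∀ g ρ → Decreasing n ρ →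
                    extend (suc c) (extend a g) ρ ≤ extend c (extend (suc a) g) ρ
  extend-transfer {a} {c} a≤c g ρ dρ = subst₂ _≤_
    (sym (extend² a (suc c) g ρ)) (sym (extend² (suc a) c g ρ))
    (∑-mono layers λ {μ} μ∈ → *-monoʳ-≤ (g μ)
      (Regular.unimodal (Regular-between dρ (∈-decreasing⁻ k n μ∈)) n a c a≤c))

  count-↭ : ∀ {α β} → α ↭ β → ∀ g → count α g ≡ count β g
  count-↭ Perm.refl           g = refl
  count-↭ (Perm.prep a p)     g = count-↭ p (extend a g)
  count-↭ (Perm.swap {ys = β} a b p)   g = trans (count-↭ p (extend b (extend a g)))
    (count-cong β λ ρ dρ → extend-comm a b g ρ dρ)
  count-↭ (Perm.trans p q)    g = trans (count-↭ p g) (count-↭ q g)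

  count-transfer : ∀ {a c} → a ≤ c → ∀ α g → count (suc c ∷ a ∷ α) g ≤ count (c ∷ suc a ∷ α) g
  count-transfer {a} {c} a≤c α g = subst₂ _≤_
    -- Unimodality is stated with the smaller number first, so both lists are swapped.
    (count-↭ {a ∷ suc c ∷ α} (Perm.swap a (suc c) Perm.refl) g)
    (count-↭ {suc a ∷ c ∷ α} (Perm.swap (suc a) c Perm.refl) g)
    (count-mono α λ ρ dρ → extend-transfer a≤c g ρ dρ)

-- Dominance

-- β dominates α when its partial sums are raised by s, with equality in the end.
data Dominates : ℕ → List ℕ → List ℕ → Set where
  []  : Dominates 0 [] []
  _∷_ : ∀ {s t a b α β} → t + a ≡ s + b → Dominates t β α → Dominates s (b ∷ β) (a ∷ α)

dominates : ∀ s α β → length α ≡ length β →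
  (∀ ℓ → ℓ ≤ length α → sum (take ℓ α) ≤ s + sum (take ℓ β)) →
  s + sum β ≡ sum α → Dominates s β α
dominates s []      []      _   _  eq with refl ← trans (sym (+-identityʳ s)) eq = []
dominates s (a ∷ α) (b ∷ β) len le eq = m∸n+n≡m a≤s+b ∷
  dominates t α β (suc-injective len)
    (λ ℓ ℓ≤ → +-cancelˡ-≤ a _ _ (≤-trans (le (suc ℓ) (s≤s ℓ≤)) (≤-reflexive (move _))))
    (+-cancelˡ-≡ a _ _ (trans (sym (move _)) eq))
  where
  -- The new surplus; the condition for ℓ = 1 makes the truncated subtraction exact.
  t = s + b ∸ a
  a≤s+b : a ≤ s + b
  a≤s+b = subst₂ _≤_ (+-identityʳ a) (cong (s +_) (+-identityʳ b)) (le 1 (s≤s z≤n))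
  move : ∀ y → s + (b + y) ≡ a + (t + y)
  move y = begin
    s + (b + y) ≡⟨ +-assoc s b y ⟨
    s + b + y   ≡⟨ cong (_+ y) (m∸n+n≡m a≤s+b) ⟨
    t + a + y   ≡⟨ cong (_+ y) (+-comm t a) ⟩
    a + t + y   ≡⟨ +-assoc a t y ⟩
    a + (t + y) ∎
    where open ≡-Reasoning

-- A positive surplus must be used up by the end, so some entry of β is below the entry of α in its
-- position, hence below the common bound. The first such entry receives one unit. The remaining
-- entries `γ` are the same before and after, as `count-transfer` requires.
deposit : ∀ {s α β a} → Dominates (suc s) β α → All (_≤ a) α →
  ∃ λ x → ∃ λ γ → ∃ λ β⁺ →
    x < a × β ↭ x ∷ γ × β⁺ ↭ suc x ∷ γ × Dominates s β⁺ α
deposit {s} {a ∷ α} {b ∷ β} (_∷_ {t = t} eq d) (a≤ ∷ α≤) with b <? a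
... | yes b<a = b , β , suc b ∷ β , <-≤-trans b<a a≤ , Perm.refl , Perm.refl ,
                trans eq (sym (+-suc s b)) ∷ d
... | no  b≮a = aux t eq d
  where
  aux : ∀ t → t + a ≡ suc s + b → Dominates t β α → _
  -- A surplus falling to zero here would force b < a.
  aux zero    eq d = contradiction (subst (b <_) (sym eq) (s≤s (m≤n+m b s))) b≮a
  aux (suc t) eq d with deposit d α≤
  ... | x , γ , β⁺ , x< , p , p⁺ , d⁺ =
    x , b ∷ γ , b ∷ β⁺ , x< ,
    Perm.trans (Perm.prep b p) (Perm.swap b x Perm.refl) ,
    Perm.trans (Perm.prep b p⁺) (Perm.swap b (suc x) Perm.refl) ,
    suc-injective eq ∷ d⁺

-- On indices, both sides list every element of `Fin m` exactly once, hence agree as bags; the claim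
-- is the image of this under α.
tabulate-↭ : ∀ {m} (α : Vector A m) (σ : Permutation′ m) →
             tabulate (λ i → α (σ ⟨$⟩ʳ i)) ↭ tabulate α
tabulate-↭ {m = m} α σ = subst₂ _↭_
  (trans (cong (map α) (List.map-tabulate (λ i → i) (σ ⟨$⟩ʳ_))) (List.map-tabulate (σ ⟨$⟩ʳ_) α))
  (List.map-tabulate (λ i → i) α)
  (Perm.map⁺ α (∼bag⇒↭ (unique∧set⇒bag
    (Unique.map⁺ σ-injective (Unique.allFin⁺ m)) (Unique.allFin⁺ m)
    (λ {i} → mk⇔ (λ _ → ∈-allFin i)
         (λ _ → subst (_∈ _) (inverseʳ σ) (∈-map⁺ (σ ⟨$⟩ʳ_) (∈-allFin (σ ⟨$⟩ˡ i))))))))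
  where
  σ-injective : ∀ {i j} → σ ⟨$⟩ʳ i ≡ σ ⟨$⟩ʳ j → i ≡ j
  σ-injective eq = trans (sym (inverseˡ σ)) (trans (cong (σ ⟨$⟩ˡ_) eq) (inverseˡ σ))

module Dominance (k n : ℕ) where
  open Layers k n

  -- The head of β exceeds that of α by t; one unit at a time is moved to an
  -- entry smaller than it.
  count-dominated : ∀ {α β} → AllPairs _≥_ α → Dominates 0 β α → ∀ g → count β g ≤ count α g
  count-dominated []          []                   g = ≤-refl
  count-dominated {a ∷ α} (α≤a ∷ dec) (_∷_ {t = t} {β = β} refl d) g = lower-head t β d
    where
    lower-head : ∀ t β → Dominates t β α → count (t + a ∷ β) g ≤ count (a ∷ α) g
    lower-head zero    β d = count-dominated dec d (extend a g)
    -- Since α is weakly decreasing, `a` bounds its tail, so the receiving entry satisfies x < a ≤ t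
    -- + a and the transfer is towards the middle.
    lower-head (suc t) β d with deposit d α≤a
    ... | x , γ , β⁺ , x<a , p , p⁺ , d⁺ = begin
      count (suc t + a ∷ β) g           ≡⟨ count-↭ (Perm.prep (suc t + a) p) g ⟩
      count (suc (t + a) ∷ x ∷ γ) g     ≤⟨ count-transfer (≤-trans (<⇒≤ x<a) (m≤n+m a t)) γ g ⟩
      count (t + a ∷ suc x ∷ γ) g       ≡⟨ count-↭ (Perm.prep (t + a) p⁺) g ⟨
      count (t + a ∷ β⁺) g              ≤⟨ lower-head t β⁺ d⁺ ⟩
      count (a ∷ α) g                   ∎
      where open ≤-Reasoning

-- Sizes of subsets listed without repetition

lookup-injective : ∀ {xs : List A} → Unique xs → ∀ i j → lookup xs i ≡ lookup xs j → i ≡ j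
lookup-injective (_ ∷ _)  zero    zero    _  = refl
lookup-injective (x∉ ∷ _) zero    (suc j) eq = contradiction eq (All.lookup x∉ (∈-lookup j))
lookup-injective (x∉ ∷ _) (suc i) zero    eq = contradiction (sym eq) (All.lookup x∉ (∈-lookup i))
lookup-injective (_ ∷ u)  (suc i) (suc j) eq = cong suc (lookup-injective u i j eq)

module _ (S : Setoid 0ℓ 0ℓ) (P : Setoid.Carrier S → Set) where
  private module S = Setoid S

  sizeList : (xs : List A) (f : A → S.Carrier) → Unique xs →
    (∀ {x} → x ∈ xs → P (f x)) →
    (∀ {x y} → x ∈ xs → y ∈ xs → f x S.≈ f y → x ≡ y) →
    (∀ s → P s → ∃ λ x → x ∈ xs × f x S.≈ s) →
    HasSize S P (length xs)
  sizeList xs f unique sound inj cover = record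
    { to        = λ i → f (lookup xs i) , sound (∈-lookup i)
    ; from      = from
    ; to-cong   = λ eq → S.reflexive (cong (f ∘ lookup xs) eq)
    ; from-cong = λ {x} {y} eq → f∘lookup-injective
        (S.trans (to∘from x) (S.trans eq (S.sym (to∘from y))))
    ; inverse   = (λ { {x} refl → to∘from x })
                , (λ { {i} {x} eq → f∘lookup-injective (S.trans (to∘from x) eq) })
    }
    where
    from : ∃ P → Fin (length xs)
    from (s , p) = Any.index (proj₁ (proj₂ (cover s p)))
    to∘from : ∀ x → f (lookup xs (from x)) S.≈ proj₁ x
    to∘from (s , p) with cover s p
    ... | x , x∈ , eq = S.trans (S.reflexive (cong f (sym (lookup-index x∈)))) eq
    f∘lookup-injective : ∀ {i j} → f (lookup xs i) S.≈ f (lookup xs j) → i ≡ j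
    f∘lookup-injective {i} {j} eq = lookup-injective unique i j (inj (∈-lookup i) (∈-lookup j) eq)

-- Plane partitions as chains of layers

infixl 9 _‼_
-- The j-th entry, or 0 past the end.
_‼_ : Vec ℕ k → ℕ → ℕ
[]       ‼ _     = 0
(x ∷ _)  ‼ zero  = x
(_ ∷ xs) ‼ suc j = xs ‼ j

‼-injective : {us ws : Vec ℕ k} → (∀ j → us ‼ j ≡ ws ‼ j) → us ≡ ws
‼-injective {us = []}    {[]}    eq = refl
‼-injective {us = _ ∷ _} {_ ∷ _} eq = cong₂ _∷_ (eq 0) (‼-injective (eq ∘ suc))

‼-beyond : (us : Vec ℕ k) → ∀ {j} → k ≤ j → us ‼ j ≡ 0
‼-beyond []       _         = refl
‼-beyond (_ ∷ us) (s≤s k≤j) = ‼-beyond us k≤j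

‼-replicate : ∀ k j → replicate k 0 ‼ j ≡ 0
‼-replicate zero    j       = refl
‼-replicate (suc k) zero    = refl
‼-replicate (suc k) (suc j) = ‼-replicate k j

‼-tabulate : ∀ k (f : ℕ → ℕ) → (∀ j → k ≤ j → f j ≡ 0) →
             ∀ j → Vec.tabulate {n = k} (f ∘ toℕ) ‼ j ≡ f j
‼-tabulate zero    f z j       = sym (z j z≤n)
‼-tabulate (suc k) f z zero    = refl
‼-tabulate (suc k) f z (suc j) = ‼-tabulate k (f ∘ suc) (λ j k≤j → z (suc j) (s≤s k≤j)) j

Decreasing-‼ : ∀ {v} {us : Vec ℕ k} → Decreasing v us → ∀ j → us ‼ suc j ≤ us ‼ j
Decreasing-‼ []            j       = z≤n
Decreasing-‼ (_ ∷ [])      zero    = z≤n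
Decreasing-‼ (_ ∷ le ∷ _)  zero    = le
Decreasing-‼ (_ ∷ ds)      (suc j) = Decreasing-‼ ds j

Decreasing-‼-≤ : ∀ {v} {us : Vec ℕ k} → Decreasing v us → ∀ j → us ‼ j ≤ v
Decreasing-‼-≤ []        j       = z≤n
Decreasing-‼-≤ (le ∷ _)  zero    = le
Decreasing-‼-≤ (le ∷ ds) (suc j) = ≤-trans (Decreasing-‼-≤ ds j) le

Decreasing-tabulate : ∀ k {v} (f : ℕ → ℕ) → f 0 ≤ v → (∀ j → f (suc j) ≤ f j) →
                      Decreasing v (Vec.tabulate {n = k} (f ∘ toℕ))
Decreasing-tabulate zero    f f≤v dec = []
Decreasing-tabulate (suc k) f f≤v dec = f≤v ∷ Decreasing-tabulate k (f ∘ suc) (dec 0) (dec ∘ suc)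

Step-‼-≤ : ∀ {a} {us ws : Vec ℕ k} → Step a us ws → ∀ j → ws ‼ j ≤ us ‼ j
Step-‼-≤ []            j       = z≤n
Step-‼-≤ (keep s)      zero    = ≤-refl
Step-‼-≤ (keep s)      (suc j) = Step-‼-≤ s j
Step-‼-≤ (lower w<u s) zero    = <⇒≤ w<u
Step-‼-≤ (lower w<u s) (suc j) = Step-‼-≤ s j

step-exists : {us ws : Vec ℕ k} → (∀ j → ws ‼ j ≤ us ‼ j) → ∃ λ a → Step a us ws
step-exists {us = []}    {[]}    le = 0 , []
step-exists {us = u ∷ us} {w ∷ ws} le
  with step-exists {us = us} {ws} (le ∘ suc) | m≤n⇒m<n∨m≡n (le 0)
... | a , s | inj₁ w<u  = suc a , lower w<u s
... | a , s | inj₂ refl = a , keep s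

-- Between consecutive layers, these are the columns that contain the descents of one entry.
drops : ∀ {a} {us ws : Vec ℕ k} → Step a us ws → List ℕ
drops []          = []
drops (keep s)    = map suc (drops s)
drops (lower _ s) = 0 ∷ map suc (drops s)

length-drops : ∀ {a} {us ws : Vec ℕ k} (s : Step a us ws) → length (drops s) ≡ a
length-drops []          = refl
length-drops (keep s)    = trans (List.length-map suc (drops s)) (length-drops s)
length-drops (lower _ s) = cong suc (trans (List.length-map suc (drops s)) (length-drops s))

drops-unique : ∀ {a} {us ws : Vec ℕ k} (s : Step a us ws) → Unique (drops s)
drops-unique []          = []
drops-unique (keep s)    = Unique.map⁺ suc-injective (drops-unique s)
drops-unique (lower _ s) =
  All.tabulate (λ { j∈ refl → 0∉ j∈ }) ∷ Unique.map⁺ suc-injective (drops-unique s)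
  where
  0∉ : ¬ 0 ∈ map suc (drops s)
  0∉ 0∈ with ∈-map⁻ suc 0∈
  ... | _ , _ , ()

∈-drops⁻ : ∀ {a} {us ws : Vec ℕ k} (s : Step a us ws) {j} → j ∈ drops s → ws ‼ j < us ‼ j
∈-drops⁻ (keep s) j∈ with ∈-map⁻ suc j∈
... | _ , i∈ , refl = ∈-drops⁻ s i∈
∈-drops⁻ (lower w<u s) (here refl) = w<u
∈-drops⁻ (lower w<u s) (there j∈) with ∈-map⁻ suc j∈
... | _ , i∈ , refl = ∈-drops⁻ s i∈

∈-drops⁺ : ∀ {a} {us ws : Vec ℕ k} (s : Step a us ws) j → ws ‼ j < us ‼ j → j ∈ drops s
∈-drops⁺ (keep s)    zero    lt = contradiction lt (<-irrefl refl)
∈-drops⁺ (keep s)    (suc j) lt = ∈-map⁺ suc (∈-drops⁺ s j lt)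
∈-drops⁺ (lower _ s) zero    lt = here refl
∈-drops⁺ (lower _ s) (suc j) lt = there (∈-map⁺ suc (∈-drops⁺ s j lt))

-- Entries and heights are known through the numbers strictly below them, as in `Heights`, so they
-- are compared this way.
below⇒≤ : ∀ {x y} → (∀ r → r < x → r < y) → x ≤ y
below⇒≤ {zero}  h = z≤n
below⇒≤ {suc x} h = h x ≤-refl

below⇒≡ : ∀ {x y} → (∀ r → r < x → r < y) → (∀ r → r < y → r < x) → x ≡ y
below⇒≡ h h′ = ≤-antisym (below⇒≤ h) (below⇒≤ h′)

-- The conjugate of the partition f 0 ≥ f 1 ≥ …, whose parts from N on vanish.
conjugate : ℕ → (ℕ → ℕ) → ℕ → ℕ
conjugate zero    f i = 0
conjugate (suc N) f i with i <? f 0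
... | yes _ = suc (conjugate N (f ∘ suc) i)
... | no  _ = 0

<-conjugate⁻ : ∀ N f i r → r < conjugate N f i → i < f r
<-conjugate⁻ (suc N) f i r       lt with i <? f 0
<-conjugate⁻ (suc N) f i zero    lt       | yes i<f0 = i<f0
<-conjugate⁻ (suc N) f i (suc r) (s≤s lt) | yes _    = <-conjugate⁻ N (f ∘ suc) i r lt

-- `conjugate` stops at the first part that is at most i; monotonicity ensures that no later part
-- exceeds i.
<-conjugate⁺ : ∀ N f → (∀ r → f (suc r) ≤ f r) → (∀ r → N ≤ r → f r ≡ 0) →
               ∀ i r → i < f r → r < conjugate N f i
<-conjugate⁺ zero    f dec z i r lt = contradiction (subst (i <_) (z r z≤n) lt) λ ()
<-conjugate⁺ (suc N) f dec z i r lt with i <? f 0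
<-conjugate⁺ (suc N) f dec z i zero    lt | yes _ = s≤s z≤n
<-conjugate⁺ (suc N) f dec z i (suc r) lt | yes _ =
  s≤s (<-conjugate⁺ N (f ∘ suc) (dec ∘ suc) (λ r N≤r → z (suc r) (s≤s N≤r)) i r lt)
... | no i≮f0 = contradiction (<-≤-trans lt (first r)) i≮f0
  where
  first : ∀ r → f r ≤ f 0
  first zero    = ≤-refl
  first (suc r) = ≤-trans (dec r) (first r)

-- h i j is the number of entries of column j of π greater than i.
record Heights (π : Array) (h : ℕ → ℕ → ℕ) : Set where
  field
    entry  : ∀ {i j r} → r < h i j → i < π (r , j)
    height : ∀ {i j r} → i < π (r , j) → r < h i j

-- Column j contains the entry i + 1 exactly when its height drops from layer i to layer i + 1. Its
-- lowest occurrence, the descent, is then in row h i j - 1, rows being numbered from 0.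
descents : ∀ {π h a i} {μ ν : Vec ℕ k} → Heights π h →
           (∀ j → μ ‼ j ≡ h i j) → (∀ j → ν ‼ j ≡ h (suc i) j) → Step a μ ν →
           Exactly a (IsDescent π (suc i))
descents {π = π} {h} {a} {i} {μ} {ν} H eμ eν s =
  subst (λ a → Exactly a (IsDescent π (suc i))) (length-drops s)
    (sizeList (setoid (ℕ × ℕ)) _ (drops s) (λ j → pred (h i j) , j) (drops-unique s)
      (λ {j} j∈ → sound j (subst₂ _<_ (eν j) (eμ j) (∈-drops⁻ s j∈)))
      (λ _ _ → cong proj₂)
      λ (r , j) d → j ,
        ∈-drops⁺ s j (subst₂ _<_ (sym (eν j)) (trans (sym (top d)) (sym (eμ j))) (s≤s (under d))) ,
        cong (_, j) (cong pred (top d)))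
  where
  open Heights H
  sound : ∀ j → h (suc i) j < h i j → IsDescent π (suc i) (pred (h i j) , j)
  sound j lt = go (h i j) refl lt
    where
    go : ∀ x → h i j ≡ x → h (suc i) j < x → IsDescent π (suc i) (pred x , j)
    go (suc r) eq (s≤s le) =
      ≤-antisym (≮⇒≥ λ lt → <⇒≱ (height lt) le) (entry (≤-reflexive (sym eq))) ,
      s≤s (≮⇒≥ λ lt → <-irrefl (sym eq) (height lt))
  top : ∀ {r j} → IsDescent π (suc i) (r , j) → h i j ≡ suc r
  top (e , s≤s le) = ≤-antisym (≮⇒≥ λ lt → <⇒≱ (entry lt) le) (height (≤-reflexive (sym e)))
  under : ∀ {r j} → IsDescent π (suc i) (r , j) → h (suc i) j ≤ r
  under (e , _) = ≮⇒≥ λ lt → <-irrefl (sym e) (entry lt)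

-- The bijection between chains and plane partitions

module Chains (k n : ℕ) where
  open Layers k n

  -- The default past the end is the convention that the layer after the last one is empty.
  layer : List Layer → ℕ → Layer
  layer []      _       = empty
  layer (μ ∷ _) zero    = μ
  layer (_ ∷ c) (suc i) = layer c i

  data Chain : List ℕ → List Layer → Set where
    []   : Chain [] []
    cons : ∀ {a α μ c} → Decreasing n μ → Step a μ (layer c 0) → Chain α c → Chain (a ∷ α) (μ ∷ c)

  firstStep? : ∀ a c → Dec (Step a (layer c 0) (layer c 1))
  firstStep? a c = step? a (layer c 0) (layer c 1)

  prepend : List Layer → Layer → List Layer
  prepend c μ = μ ∷ c

  -- The tail is chosen first and the layer in front of it second, so that the inner sum over a
  -- candidate list is `extend`.
  chains : List ℕ → List (List Layer)
  chains []      = [] ∷ []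
  chains (a ∷ α) = filter (firstStep? a) (cartesianProductWith prepend (chains α) layers)

  chains-unique : ∀ α → Unique (chains α)
  chains-unique []      = [] ∷ []
  chains-unique (a ∷ α) = Unique.filter⁺ _ (Unique.cartesianProductWith⁺ _
    (λ eq → List.∷-injectiveʳ eq , List.∷-injectiveˡ eq) (chains-unique α) (decreasing-unique k n))

  ∈-chains⁻ : ∀ α {c} → c ∈ chains α → Chain α c
  ∈-chains⁻ []      (here refl) = []
  ∈-chains⁻ (a ∷ α) c∈
    with ∈-filter⁻ (firstStep? a) {xs = cartesianProductWith prepend (chains α) layers} c∈
  ... | c∈′ , s with ∈-cartesianProductWith⁻ prepend (chains α) layers c∈′
  ...   | _ , _ , d∈ , μ∈ , refl = cons (∈-decreasing⁻ k n μ∈) s (∈-chains⁻ α d∈)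

  ∈-chains⁺ : ∀ {α c} → Chain α c → c ∈ chains α
  ∈-chains⁺ []           = here refl
  ∈-chains⁺ {a ∷ α} (cons d s ch) = ∈-filter⁺ (firstStep? a)
    (∈-cartesianProductWith⁺ prepend (∈-chains⁺ ch) (∈-decreasing⁺ n d)) s

  -- The weight `g` is arbitrary so that the induction can absorb the first layer into `extend a g`.
  ∑-chains : ∀ α g → ∑ (chains α) (λ c → g (layer c 0)) ≡ count α g
  ∑-chains []      g = +-identityʳ _
  ∑-chains (a ∷ α) g = begin
    ∑ (chains (a ∷ α)) (λ c → g (layer c 0))
      ≡⟨ ∑-filter (firstStep? a) candidates _ ⟩
    ∑ candidates (λ c → steps (layer c 0) (layer c 1) a * g (layer c 0))
      ≡⟨ ∑-cartesianProductWith prepend (chains α) layers _ ⟩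
    ∑ (chains α) (λ c → extend a g (layer c 0))
      ≡⟨ ∑-chains α (extend a g) ⟩
    count (a ∷ α) g ∎
    where
    open ≡-Reasoning
    candidates : List (List Layer)
    candidates = cartesianProductWith prepend (chains α) layers

  length-chains : ∀ α → length (chains α) ≡ count α (const 1)
  length-chains α = trans (sym (∑-1 (chains α))) (∑-chains α (const 1))

  layer-beyond : ∀ c {i} → length c ≤ i → layer c i ≡ empty
  layer-beyond []      _        = refl
  layer-beyond (_ ∷ c) (s≤s le) = layer-beyond c le

  layer-injective : ∀ {c d} → length c ≡ length d → (∀ i → layer c i ≡ layer d i) → c ≡ d
  layer-injective {[]}    {[]}    _   _  = refl
  layer-injective {_ ∷ _} {_ ∷ _} len eq =
    cong₂ _∷_ (eq 0) (layer-injective (suc-injective len) (eq ∘ suc))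

  Chain-length : ∀ {α c} → Chain α c → length c ≡ length α
  Chain-length []            = refl
  Chain-length (cons _ _ ch) = cong suc (Chain-length ch)

  Chain-decreasing : ∀ {α c} → Chain α c → ∀ i → Decreasing n (layer c i)
  Chain-decreasing []            i       = empty-decreasing
  Chain-decreasing (cons d _ _)  zero    = d
  Chain-decreasing (cons _ _ ch) (suc i) = Chain-decreasing ch i

  Chain-‼ : ∀ {α c} → Chain α c → ∀ i j → layer c (suc i) ‼ j ≤ layer c i ‼ j
  Chain-‼ []            i       j = ≤-refl
  Chain-‼ (cons _ s _)  zero    j = Step-‼-≤ s j
  Chain-‼ (cons _ _ ch) (suc i) j = Chain-‼ ch i j

  Chain-step : ∀ {m} {α : Vector ℕ m} {c} → Chain (tabulate α) c →
               ∀ i → Step (α i) (layer c (toℕ i)) (layer c (suc (toℕ i)))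
  Chain-step (cons _ s _)  zero    = s
  Chain-step (cons _ _ ch) (suc i) = Chain-step ch i

  Chain-applyUpTo : ∀ {m} (α : Vector ℕ m) (f : ℕ → Layer) → (∀ i → Decreasing n (f i)) →
    (∀ i → Step (α i) (f (toℕ i)) (f (suc (toℕ i)))) → f m ≡ empty →
    Chain (tabulate α) (applyUpTo f m)
  Chain-applyUpTo {zero}  α f dec s e = []
  Chain-applyUpTo {suc m} α f dec s e = cons (dec 0)
    (subst (Step (α zero) (f 0)) (next m e) (s zero))
    (Chain-applyUpTo (α ∘ suc) (f ∘ suc) (dec ∘ suc) (s ∘ suc) e)
    where
    -- The last layer of the list is followed by the default `empty`, which the value of the
    -- function at the end has to match.
    next : ∀ m → f (suc m) ≡ empty → f 1 ≡ layer (applyUpTo (f ∘ suc) m) 0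
    next zero    e = e
    next (suc m) e = refl

  layer-applyUpTo : ∀ (f : ℕ → Layer) m → (∀ i → m ≤ i → f i ≡ empty) →
                    ∀ i → layer (applyUpTo f m) i ≡ f i
  layer-applyUpTo f zero    z i       = sym (z i z≤n)
  layer-applyUpTo f (suc m) z zero    = refl
  layer-applyUpTo f (suc m) z (suc i) =
    layer-applyUpTo (f ∘ suc) m (λ i m≤i → z (suc i) (s≤s m≤i)) i

  module _ {m : ℕ} (α : Vector ℕ m) where

    -- The entry at (r, j) is the number of layers whose height in column j exceeds r.
    array : List Layer → Array
    array c (r , j) = conjugate m (λ i → layer c i ‼ j) r

    array-heights : ∀ {c} → Chain (tabulate α) c → Heights (array c) (λ i j → layer c i ‼ j)
    array-heights {c} ch = record
      { entry  = λ {i} {j} {r} →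
          <-conjugate⁺ m (λ i → layer c i ‼ j) (λ i → Chain-‼ ch i j) (beyond j) r i
      ; height = λ {i} {j} {r} → <-conjugate⁻ m (λ i → layer c i ‼ j) r i
      }
      where
      length≡m : length c ≡ m
      length≡m = trans (Chain-length ch) (List.length-tabulate α)
      beyond : ∀ j i → m ≤ i → layer c i ‼ j ≡ 0
      beyond j i m≤i = trans
        (cong (_‼ j) (layer-beyond c (subst (_≤ i) (sym length≡m) m≤i))) (‼-replicate k j)

    array-boxed : ∀ {c} → Chain (tabulate α) c → BoxedPP k n m (array c)
    array-boxed {c} ch = record
      { columns = λ r j → below⇒≤ λ i lt → entry {i} {j} (<⇒≤ (height lt))
      ; rows    = λ r j → below⇒≤ λ i lt →
                    entry {i} {j} (<-≤-trans (height lt) (Decreasing-‼ (Chain-decreasing ch i) j))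
      ; below   = λ r j n≤r → n≤0⇒n≡0 (≮⇒≥ λ lt →
                    <⇒≱ (<-≤-trans (height {0} {j} lt)
                                   (Decreasing-‼-≤ (Chain-decreasing ch 0) j)) n≤r)
      ; right   = λ r j k≤j → n≤0⇒n≡0 (≮⇒≥ λ lt →
                    <⇒≱ (height {0} {j} {r} lt)
                        (≤-trans (≤-reflexive (‼-beyond (layer c 0) k≤j)) z≤n))
      ; corner  = conjugate≤ m _ 0
      }
      where
      open Heights (array-heights ch)
      conjugate≤ : ∀ N f i → conjugate N f i ≤ N
      conjugate≤ zero    f i = z≤n
      conjugate≤ (suc N) f i with i <? f 0
      ... | yes _ = s≤s (conjugate≤ N (f ∘ suc) i)
      ... | no  _ = z≤n

    array-sound : ∀ {c} → Chain (tabulate α) c → PPWithDescents k n m α (array c)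
    array-sound ch = Boxed⇒PP (array-boxed ch) , λ i →
      descents (array-heights ch) (λ _ → refl) (λ _ → refl) (Chain-step ch i)

    array-injective : ∀ {c d} → Chain (tabulate α) c → Chain (tabulate α) d →
                      array c ≗ array d → c ≡ d
    array-injective ch ch′ eq = layer-injective (trans (Chain-length ch) (sym (Chain-length ch′)))
      λ i → ‼-injective λ j → below⇒≡
        (λ r lt → H′.height (subst (i <_) (eq (r , j)) (H.entry lt)))
        (λ r lt → H.height (subst (i <_) (sym (eq (r , j))) (H′.entry lt)))
      where
      module H  = Heights (array-heights ch)
      module H′ = Heights (array-heights ch′)

    array-cover : ∀ π → PPWithDescents k n m α π → ∃ λ c → Chain (tabulate α) c × array c ≗ π
    array-cover π (pp , ds) = c , ch , λ (r , j) → below⇒≡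
      (λ i lt → entry (subst (r <_) (layer-c i j) (K.height lt)))
      (λ i lt → K.entry (subst (r <_) (sym (layer-c i j)) (height lt)))
      where
      open BoxedPP (PP⇒Boxed pp)
      h : ℕ → ℕ → ℕ
      h i j = conjugate n (λ r → π (r , j)) i
      H : Heights π h
      H = record
        { entry  = λ {i} {j} {r} → <-conjugate⁻ n (λ r → π (r , j)) i r
        ; height = λ {i} {j} {r} →
            <-conjugate⁺ n (λ r → π (r , j)) (λ r → columns r j) (λ r → below r j) i r
        }
      open Heights H
      h-right : ∀ i j → k ≤ j → h i j ≡ 0
      h-right i j k≤j = n≤0⇒n≡0 (≮⇒≥ λ lt →
        contradiction (subst (i <_) (right 0 j k≤j) (entry lt)) λ ())
      h-zero : ∀ i j → m ≤ i → h i j ≡ 0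
      h-zero i j m≤i = n≤0⇒n≡0 (≮⇒≥ λ lt → <⇒≱ (entry lt) (≤-trans (entry≤m 0 j) m≤i))
      f : ℕ → Layer
      f i = Vec.tabulate (h i ∘ toℕ)
      f-‼ : ∀ i j → f i ‼ j ≡ h i j
      f-‼ i = ‼-tabulate k (h i) (h-right i)
      f-zero : ∀ i → m ≤ i → f i ≡ empty
      f-zero i m≤i = ‼-injective λ j →
        trans (f-‼ i j) (trans (h-zero i j m≤i) (sym (‼-replicate k j)))
      f-decreasing : ∀ i → Decreasing n (f i)
      f-decreasing i = Decreasing-tabulate k (h i)
        (below⇒≤ λ r lt → inRow r 0 λ eq → contradiction (subst (i <_) eq (entry lt)) λ ())
        (λ j → below⇒≤ λ r lt → height (<-≤-trans (entry lt) (rows r j)))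
      -- The layers are nested, so some number of drops exists; by `descents` it is the number of
      -- descents of this entry, which is α i by uniqueness of sizes.
      f-step : ∀ i → Step (α i) (f (toℕ i)) (f (suc (toℕ i)))
      f-step i = subst (λ a → Step a (f (toℕ i)) (f (suc (toℕ i))))
        (HasSize-unique (descents H (f-‼ _) (f-‼ _) (proj₂ s)) (ds i)) (proj₂ s)
        where
        s : ∃ λ a → Step a (f (toℕ i)) (f (suc (toℕ i)))
        s = step-exists λ j → subst₂ _≤_ (sym (f-‼ _ j)) (sym (f-‼ _ j))
              (below⇒≤ λ r lt → height (<⇒≤ (entry lt)))
      c : List Layer
      c = applyUpTo f m
      layer-c : ∀ i j → layer c i ‼ j ≡ h i j
      layer-c i j = trans (cong (_‼ j) (layer-applyUpTo f m f-zero i)) (f-‼ i j)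
      ch : Chain (tabulate α) c
      ch = Chain-applyUpTo α f f-decreasing f-step (f-zero m ≤-refl)
      module K = Heights (array-heights ch)

    D≡count : D k n m α ≡ count (tabulate α) (const 1)
    D≡count = trans (HasSize-unique (D-size k n m α)
      (sizeList arrays _ (chains (tabulate α)) array (chains-unique (tabulate α))
        (array-sound ∘ ∈-chains⁻ _)
        (λ c∈ d∈ → array-injective (∈-chains⁻ _ c∈) (∈-chains⁻ _ d∈))
        λ π p → let c , ch , eq = array-cover π p in c , ∈-chains⁺ ch , eq))
      (length-chains (tabulate α))

theorem8p1 : (k n m : ℕ) → 1 ≤ k → 1 ≤ n → 1 ≤ m →
    ((α : Vector ℕ m) (σ : Permutation′ m) → D k n m (λ i → α (σ ⟨$⟩ʳ i)) ≡ D k n m α)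
    × ((α β : Vector ℕ m) → WeaklyDecreasing α → β ⪰ α → ∣ α ∣ ≡ ∣ β ∣ → D k n m α ≥ D k n m β)
theorem8p1 k n m _ _ _ = symmetry , monotonicity
  where
  open Layers k n
  open Chains k n
  open Dominance k n
  symmetry : (α : Vector ℕ m) (σ : Permutation′ m) → D k n m (λ i → α (σ ⟨$⟩ʳ i)) ≡ D k n m α
  symmetry α σ = begin
    D k n m (λ i → α (σ ⟨$⟩ʳ i))                   ≡⟨ D≡count _ ⟩
    count (tabulate (λ i → α (σ ⟨$⟩ʳ i))) (const 1) ≡⟨ count-↭ (tabulate-↭ α σ) (const 1) ⟩
    count (tabulate α) (const 1)                    ≡⟨ D≡count α ⟨
    D k n m α                                       ∎
    where open ≡-Reasoning
  monotonicity : (α β : Vector ℕ m) → WeaklyDecreasing α → β ⪰ α → ∣ α ∣ ≡ ∣ β ∣ →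
                 D k n m α ≥ D k n m β
  monotonicity α β dec dom eq = subst₂ _≤_ (sym (D≡count β)) (sym (D≡count α))
    (count-dominated (AllPairs.tabulate⁺-< λ i<j → dec _ _ (<⇒≤ i<j))
      (dominates 0 (tabulate α) (tabulate β)
        (trans (List.length-tabulate α) (sym (List.length-tabulate β)))
        partial (sym eq))
      (const 1))
    where
    partial : ∀ ℓ → ℓ ≤ length (tabulate α) → partialSum ℓ α ≤ partialSum ℓ β
    partial zero    _  = z≤n
    partial (suc ℓ) le = dom (suc ℓ) (s≤s z≤n) (subst (suc ℓ ≤_) (List.length-tabulate α) le)
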